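{- GREEDY is at most $0.5$-competitive on log-normalized $c$-regular graphs when $c\to\infty$: if $\rho(c)$ denotes the competitive ratio of GREEDY on log-normalized $c$-regular graphs, i.e. the infimum, over all finite log-normalized $c$-regular stochastic bipartite multigraphs (with nonempty vertex set) and all fixed edge arrival orders, of the ratio of the expected size of GREEDY's matching to $\mathrm{OPT}$, then $\limsup_{c\to\infty}\rho(c)\le \tfrac12$.
   Context: Stochastic bipartite graph: a finite bipartite multigraph $G=(L,R,E)$ (parallel edges allowed) in which each edge $e\in E$ is realized independently with probability $p_e$. Edges arrive one by one in a fixed order that is independent of the realizations. GREEDY adds each arriving realized edge to the matching if both its endpoints are currently unmatched. $\mathrm{OPT}$ is the expected size of a maximum matching of the realized graph. $E_v$ is the multiset of edges incident to $v$. The log-normalized weight of $e$ is $w_e=-\ln(1-p_e)$. For $c>0$, $G$ is log-normalized $c$-regular if $\sum_{e\in E_v}w_e=c$ for every $v\in L\cup R$. -}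

module Defs where

open import Data.Bool.Base using (if_then_else_; _∧_)
open import Data.Fin.Base using (Fin; zero; suc)
open import Data.Fin.Permutation using (Permutation′; _⟨$⟩ʳ_)
open import Data.Fin.Properties using (_≟_; all?)
open import Data.Fin.Subset
  using (Subset; inside; outside; _∈_; _⊆_; ∣_∣; ⊥; ⁅_⁆; _∪_)
open import Data.Fin.Subset.Properties using (_∈?_; _⊆?_)
open import Data.Integer.Base using (+_)
open import Data.List.Base using (List; []; _∷_; _++_; map; filter; foldl; tabulate)
open import Data.List.Extrema.Nat using (max)
open import Data.Nat.Base as ℕ using (ℕ; zero; suc; _!)
import Data.Nat.Properties as ℕ
open import Data.Product.Base using (Σ-syntax; ∃-syntax; _×_; _,_)
open import Data.Rational.Base as ℚ using (ℚ; 0ℚ; 1ℚ)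
import Data.Rational.Properties as ℚ
open import Data.Rational.Solver using (module +-*-Solver)
open import Data.Sum.Base using (_⊎_; inj₁; inj₂)
import Data.Vec.Base as Vec
import Data.Vec.Functional as Vector
open import Function.Base using (_∘_)
open import Relation.Binary.PropositionalEquality
  using (_≡_; _≢_; refl; sym; trans; cong; cong₂; subst)
open import Relation.Nullary using (¬_; Dec; does)
open import Relation.Nullary.Decidable using (¬?; _×-dec_; _→-dec_)

------------------------------------------------------------------------
-- Real numbers: Cauchy sequences of rationals, with setoid equality _≈_.
-- All operations are pointwise.

IsCauchy : (ℕ → ℚ) → Set
IsCauchy x = ∀ ε → 0ℚ ℚ.< ε →
  ∃[ N ] (∀ m n → N ℕ.≤ m → N ℕ.≤ n → ℚ.∣ x m ℚ.- x n ∣ ℚ.≤ ε)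

record ℝ : Set where
  constructor mkℝ
  field
    seq    : ℕ → ℚ
    cauchy : IsCauchy seq

open ℝ public

infix 4 _≈_ _≤_ _<_

_≈_ : ℝ → ℝ → Set
x ≈ y = ∀ ε → 0ℚ ℚ.< ε →
  ∃[ N ] (∀ n → N ℕ.≤ n → ℚ.∣ seq x n ℚ.- seq y n ∣ ℚ.≤ ε)

_≤_ : ℝ → ℝ → Set
x ≤ y = ∀ ε → 0ℚ ℚ.< ε →
  ∃[ N ] (∀ n → N ℕ.≤ n → seq x n ℚ.≤ seq y n ℚ.+ ε)

_<_ : ℝ → ℝ → Set
x < y = ∃[ ε ] (0ℚ ℚ.< ε ×
  (∃[ N ] (∀ n → N ℕ.≤ n → seq x n ℚ.+ ε ℚ.≤ seq y n)))

open +-*-Solver using (solve; _:=_; _:+_; _:-_)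

halve : ∀ ε → 0ℚ ℚ.< ε → ∃[ δ ] (0ℚ ℚ.< δ × δ ℚ.+ δ ≡ ε)
halve ε ε>0 = ℚ.½ ℚ.* ε
  , ℚ.positive⁻¹ (ℚ.½ ℚ.* ε) {{ℚ.pos*pos⇒pos ℚ.½ ε {{ℚ.positive ε>0}}}}
  , trans (sym (ℚ.*-distribʳ-+ ε ℚ.½ ℚ.½)) (ℚ.*-identityˡ ε)

divide : ∀ K → 0ℚ ℚ.< K → ∀ ε → 0ℚ ℚ.< ε → ∃[ δ ] (0ℚ ℚ.< δ × K ℚ.* δ ≡ ε)
divide K K>0 ε ε>0 = K⁻¹ ℚ.* ε
  , ℚ.positive⁻¹ (K⁻¹ ℚ.* ε)
      {{ℚ.pos*pos⇒pos K⁻¹ {{ℚ.1/pos⇒pos K {{K-pos}}}} ε {{ℚ.positive ε>0}}}}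
  , trans (sym (ℚ.*-assoc K K⁻¹ ε))
      (trans (cong (ℚ._* ε) (ℚ.*-inverseʳ K {{K≢0}})) (ℚ.*-identityˡ ε))
  where
  K-pos : ℚ.Positive K
  K-pos = ℚ.positive K>0
  K≢0 : ℚ.NonZero K
  K≢0 = ℚ.pos⇒nonZero K {{K-pos}}
  K⁻¹ : ℚ
  K⁻¹ = (ℚ.1/ K) {{K≢0}}

∣*∣-mono : ∀ u v K δ → 0ℚ ℚ.< K →
  ℚ.∣ u ∣ ℚ.≤ K → ℚ.∣ v ∣ ℚ.≤ δ → ℚ.∣ u ℚ.* v ∣ ℚ.≤ K ℚ.* δ
∣*∣-mono u v K δ K>0 u≤K v≤δ = begin
  ℚ.∣ u ℚ.* v ∣
    ≡⟨ ℚ.∣p*q∣≡∣p∣*∣q∣ u v ⟩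
  ℚ.∣ u ∣ ℚ.* ℚ.∣ v ∣
    ≤⟨ ℚ.*-monoʳ-≤-nonNeg ℚ.∣ v ∣ {{ℚ.∣-∣-nonNeg v}} u≤K ⟩
  K ℚ.* ℚ.∣ v ∣
    ≤⟨ ℚ.*-monoˡ-≤-nonNeg K {{ℚ.nonNegative (ℚ.<⇒≤ K>0)}} v≤δ ⟩
  K ℚ.* δ ∎
  where open ℚ.≤-Reasoning

const-cauchy : ∀ q → IsCauchy (λ _ → q)
const-cauchy q ε ε>0 = 0 , λ _ _ _ _ →
  subst (λ z → ℚ.∣ z ∣ ℚ.≤ ε) (sym (ℚ.+-inverseʳ q)) (ℚ.<⇒≤ ε>0)

neg-cauchy : ∀ x → IsCauchy x → IsCauchy (λ n → ℚ.- x n)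
neg-cauchy x cx ε ε>0 with cx ε ε>0
... | N , h = N , λ m n N≤m N≤n →
  subst (ℚ._≤ ε)
    (trans (sym (ℚ.∣-p∣≡∣p∣ (x m ℚ.- x n)))
      (cong ℚ.∣_∣ (ℚ.neg-distrib-+ (x m) (ℚ.- x n))))
    (h m n N≤m N≤n)

+-cauchy : ∀ x y → IsCauchy x → IsCauchy y → IsCauchy (λ n → x n ℚ.+ y n)
+-cauchy x y cx cy ε ε>0 with halve ε ε>0
... | δ , δ>0 , δ+δ≡ε with cx δ δ>0 | cy δ δ>0
... | M , hx | N , hy = M ℕ.⊔ N , λ m n K≤m K≤n → begin
  ℚ.∣ (x m ℚ.+ y m) ℚ.- (x n ℚ.+ y n) ∣
    ≡⟨ cong ℚ.∣_∣ (rearrange (x m) (y m) (x n) (y n)) ⟩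
  ℚ.∣ (x m ℚ.- x n) ℚ.+ (y m ℚ.- y n) ∣
    ≤⟨ ℚ.∣p+q∣≤∣p∣+∣q∣ (x m ℚ.- x n) (y m ℚ.- y n) ⟩
  ℚ.∣ x m ℚ.- x n ∣ ℚ.+ ℚ.∣ y m ℚ.- y n ∣
    ≤⟨ ℚ.+-mono-≤
         (hx m n (ℕ.m⊔n≤o⇒m≤o M N K≤m) (ℕ.m⊔n≤o⇒m≤o M N K≤n))
         (hy m n (ℕ.m⊔n≤o⇒n≤o M N K≤m) (ℕ.m⊔n≤o⇒n≤o M N K≤n)) ⟩
  δ ℚ.+ δ
    ≡⟨ δ+δ≡ε ⟩
  ε ∎
  where
  open ℚ.≤-Reasoning
  rearrange : ∀ a b c d → (a ℚ.+ b) ℚ.- (c ℚ.+ d) ≡ (a ℚ.- c) ℚ.+ (b ℚ.- d)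
  rearrange = solve 4 (λ a b c d →
    (a :+ b) :- (c :+ d) := (a :- c) :+ (b :- d)) refl

eventually-bounded : ∀ x → IsCauchy x →
  ∃[ K ] (0ℚ ℚ.< K × (∃[ N ] (∀ n → N ℕ.≤ n → ℚ.∣ x n ∣ ℚ.≤ K)))
eventually-bounded x cx with cx 1ℚ (ℚ.positive⁻¹ 1ℚ)
... | N , h = 1ℚ ℚ.+ ℚ.∣ x N ∣ , 0<K , N , λ n N≤n → begin
  ℚ.∣ x n ∣
    ≡⟨ cong ℚ.∣_∣ (split (x n) (x N)) ⟩
  ℚ.∣ (x n ℚ.- x N) ℚ.+ x N ∣
    ≤⟨ ℚ.∣p+q∣≤∣p∣+∣q∣ (x n ℚ.- x N) (x N) ⟩
  ℚ.∣ x n ℚ.- x N ∣ ℚ.+ ℚ.∣ x N ∣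
    ≤⟨ ℚ.+-monoˡ-≤ ℚ.∣ x N ∣ (h n N N≤n ℕ.≤-refl) ⟩
  1ℚ ℚ.+ ℚ.∣ x N ∣ ∎
  where
  open ℚ.≤-Reasoning
  split : ∀ a b → a ≡ (a ℚ.- b) ℚ.+ b
  split = solve 2 (λ a b → a := (a :- b) :+ b) refl
  0<K : 0ℚ ℚ.< 1ℚ ℚ.+ ℚ.∣ x N ∣
  0<K = ℚ.+-mono-<-≤ (ℚ.positive⁻¹ 1ℚ) (ℚ.0≤∣p∣ (x N))

product-bound : ∀ a b c d A B δ₁ δ₂ → 0ℚ ℚ.< A → 0ℚ ℚ.< B →
  ℚ.∣ a ∣ ℚ.≤ A → ℚ.∣ b ℚ.- d ∣ ℚ.≤ δ₁ →
  ℚ.∣ d ∣ ℚ.≤ B → ℚ.∣ a ℚ.- c ∣ ℚ.≤ δ₂ →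
  ℚ.∣ a ℚ.* b ℚ.- c ℚ.* d ∣ ℚ.≤ A ℚ.* δ₁ ℚ.+ B ℚ.* δ₂
product-bound a b c d A B δ₁ δ₂ A>0 B>0 a≤A b-d≤δ₁ d≤B a-c≤δ₂ = begin
  ℚ.∣ a ℚ.* b ℚ.- c ℚ.* d ∣
    ≡⟨ cong ℚ.∣_∣ rearrange ⟩
  ℚ.∣ a ℚ.* (b ℚ.- d) ℚ.+ d ℚ.* (a ℚ.- c) ∣
    ≤⟨ ℚ.∣p+q∣≤∣p∣+∣q∣ (a ℚ.* (b ℚ.- d)) (d ℚ.* (a ℚ.- c)) ⟩
  ℚ.∣ a ℚ.* (b ℚ.- d) ∣ ℚ.+ ℚ.∣ d ℚ.* (a ℚ.- c) ∣
    ≤⟨ ℚ.+-mono-≤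
         (∣*∣-mono a (b ℚ.- d) A δ₁ A>0 a≤A b-d≤δ₁)
         (∣*∣-mono d (a ℚ.- c) B δ₂ B>0 d≤B a-c≤δ₂) ⟩
  A ℚ.* δ₁ ℚ.+ B ℚ.* δ₂ ∎
  where
  open ℚ.≤-Reasoning
  factor : ∀ p q r → p ℚ.* q ℚ.- p ℚ.* r ≡ p ℚ.* (q ℚ.- r)
  factor p q r = trans (cong (p ℚ.* q ℚ.+_) (ℚ.neg-distribʳ-* p r))
    (sym (ℚ.*-distribˡ-+ p q (ℚ.- r)))
  telescope : ∀ p q r → p ℚ.- r ≡ (p ℚ.- q) ℚ.+ (q ℚ.- r)
  telescope = solve 3 (λ p q r → p :- r := (p :- q) :+ (q :- r)) refl
  rearrange : a ℚ.* b ℚ.- c ℚ.* d ≡ a ℚ.* (b ℚ.- d) ℚ.+ d ℚ.* (a ℚ.- c)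
  rearrange =
    trans (telescope (a ℚ.* b) (a ℚ.* d) (c ℚ.* d))
      (cong₂ ℚ._+_ (factor a b d)
        (trans (cong₂ ℚ._-_ (ℚ.*-comm a d) (ℚ.*-comm c d)) (factor d a c)))

*-cauchy : ∀ x y → IsCauchy x → IsCauchy y → IsCauchy (λ n → x n ℚ.* y n)
*-cauchy x y cx cy ε ε>0 =
  let A , A>0 , M₁ , bx = eventually-bounded x cx
      B , B>0 , N₁ , by = eventually-bounded y cy
      η , η>0 , η+η≡ε   = halve ε ε>0
      δ₁ , δ₁>0 , Aδ₁≡η = divide A A>0 η η>0
      δ₂ , δ₂>0 , Bδ₂≡η = divide B B>0 η η>0
      M₂ , hx           = cx δ₂ δ₂>0
      N₂ , hy           = cy δ₁ δ₁>0
  in (M₁ ℕ.⊔ N₁) ℕ.⊔ (M₂ ℕ.⊔ N₂) , λ m n K≤m K≤n →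
    let m₁ = ℕ.m⊔n≤o⇒m≤o (M₁ ℕ.⊔ N₁) (M₂ ℕ.⊔ N₂) K≤m
        m₂ = ℕ.m⊔n≤o⇒n≤o (M₁ ℕ.⊔ N₁) (M₂ ℕ.⊔ N₂) K≤m
        n₁ = ℕ.m⊔n≤o⇒m≤o (M₁ ℕ.⊔ N₁) (M₂ ℕ.⊔ N₂) K≤n
        n₂ = ℕ.m⊔n≤o⇒n≤o (M₁ ℕ.⊔ N₁) (M₂ ℕ.⊔ N₂) K≤n
    in subst (ℚ.∣ x m ℚ.* y m ℚ.- x n ℚ.* y n ∣ ℚ.≤_)
         (trans (cong₂ ℚ._+_ Aδ₁≡η Bδ₂≡η) η+η≡ε)
         (product-bound (x m) (y m) (x n) (y n) A B δ₁ δ₂ A>0 B>0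
           (bx m (ℕ.m⊔n≤o⇒m≤o M₁ N₁ m₁))
           (hy m n (ℕ.m⊔n≤o⇒n≤o M₂ N₂ m₂) (ℕ.m⊔n≤o⇒n≤o M₂ N₂ n₂))
           (by n (ℕ.m⊔n≤o⇒n≤o M₁ N₁ n₁))
           (hx m n (ℕ.m⊔n≤o⇒m≤o M₂ N₂ m₂) (ℕ.m⊔n≤o⇒m≤o M₂ N₂ n₂)))

infixl 6 _+_ _-_
infixl 7 _*_
infix  8 -_
infixr 9 _^_

_+_ : ℝ → ℝ → ℝ
x + y = mkℝ (λ n → seq x n ℚ.+ seq y n)
            (+-cauchy (seq x) (seq y) (cauchy x) (cauchy y))

_*_ : ℝ → ℝ → ℝ
x * y = mkℝ (λ n → seq x n ℚ.* seq y n)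
            (*-cauchy (seq x) (seq y) (cauchy x) (cauchy y))

-_ : ℝ → ℝ
- x = mkℝ (λ n → ℚ.- seq x n) (neg-cauchy (seq x) (cauchy x))

_-_ : ℝ → ℝ → ℝ
x - y = x + (- y)

fromℚ : ℚ → ℝ
fromℚ q = mkℝ (λ _ → q) (const-cauchy q)

fromℕ : ℕ → ℝ
fromℕ n = fromℚ (+ n ℚ./ 1)

0ℝ 1ℝ ½ℝ : ℝ
0ℝ = fromℚ 0ℚ
1ℝ = fromℚ 1ℚ
½ℝ = fromℚ ℚ.½

_^_ : ℝ → ℕ → ℝ
x ^ zero  = 1ℝ
x ^ suc n = x * x ^ n

sum : ∀ {n} → (Fin n → ℝ) → ℝ
sum = Vector.foldr _+_ 0ℝ

------------------------------------------------------------------------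
-- Logarithm, as the inverse of the exponential series

infix 4 _⟶_

_⟶_ : (ℕ → ℝ) → ℝ → Set
s ⟶ ℓ = ∀ ε → 0ℚ ℚ.< ε →
  ∃[ N ] (∀ n → N ℕ.≤ n → ℓ - fromℚ ε < s n × s n < ℓ + fromℚ ε)

expTerm : ℝ → ℕ → ℝ
expTerm x k = x ^ k * fromℚ ((+ 1 ℚ./ (k !)) {{k ℕ.!≢0}})

expPartialSum : ℝ → ℕ → ℝ
expPartialSum x zero    = expTerm x zero
expPartialSum x (suc n) = expPartialSum x n + expTerm x (suc n)

-- The graph { (x , y) ∣ y = eˣ } of the exponential function; read from right
-- to left it is the graph of the natural logarithm.
IsExp : ℝ → ℝ → Set
IsExp x y = expPartialSum x ⟶ y

IsLn : ℝ → ℝ → Set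
IsLn y x = IsExp x y

------------------------------------------------------------------------
-- Infima and limits superior.  An extended real a is represented by its
-- upper cut { y ∣ a < y } (+∞ by the empty cut); every set of reals has a
-- constructive infimum in this sense, which need not exist as an element of ℝ.

Upperℝ : Set₁
Upperℝ = ℝ → Set

infix 4 _≤ᵘ_

_≤ᵘ_ : Upperℝ → ℝ → Set
U ≤ᵘ x = ∀ y → x < y → U y

inf : (ℝ → Set) → Upperℝ
inf S y = ∃[ r ] (S r × r < y)

⨅ : {I : Set} → (I → Upperℝ) → Upperℝ
⨅ U y = ∃[ i ] U i y

-- The strict inequality y′ < y is what separates sup U < y from
-- "every member is < y".
⨆ : {I : Set} → (I → Upperℝ) → Upperℝ
⨆ U y = ∃[ y′ ] (y′ < y × (∀ i → U i y′))

limsup : (ℝ → Upperℝ) → Upperℝ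
limsup u = ⨅ {I = ℝ} λ C → ⨆ {I = Σ[ c ∈ ℝ ] C ≤ c} λ (c , _) → u c

------------------------------------------------------------------------
-- Stochastic bipartite multigraphs

record StochasticGraph : Set where
  field
    nL nR nE : ℕ
    left     : Fin nE → Fin nL
    right    : Fin nE → Fin nR
    prob     : Fin nE → ℝ
    0≤prob   : ∀ e → 0ℝ ≤ prob e
    prob≤1   : ∀ e → prob e ≤ 1ℝ

  Edge Vertex : Set
  Edge   = Fin nE
  Vertex = Fin nL ⊎ Fin nR

  Incident : Edge → Vertex → Set
  Incident e (inj₁ u) = left e ≡ u
  Incident e (inj₂ v) = right e ≡ v

  incident? : ∀ e v → Dec (Incident e v)
  incident? e (inj₁ u) = left e ≟ u
  incident? e (inj₂ v) = right e ≟ v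

-- Expectation of f over the random subset of Fin n that contains each i
-- independently with probability p i.
𝔼 : ∀ {n} → (Fin n → ℝ) → (Subset n → ℝ) → ℝ
𝔼 {zero}  p f = f Vec.[]
𝔼 {suc n} p f =
    p zero * 𝔼 (p ∘ suc) (f ∘ (inside Vec.∷_))
  + (1ℝ - p zero) * 𝔼 (p ∘ suc) (f ∘ (outside Vec.∷_))

subsets : ∀ n → List (Subset n)
subsets zero    = Vec.[] ∷ []
subsets (suc n) =
  map (inside Vec.∷_) (subsets n) ++ map (outside Vec.∷_) (subsets n)

module _ (G : StochasticGraph) where
  open StochasticGraph G

  IsMatching : Subset nE → Set
  IsMatching M = ∀ e f → e ∈ M → f ∈ M → e ≢ f →
    left e ≢ left f × right e ≢ right f

  isMatching? : ∀ M → Dec (IsMatching M)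
  isMatching? M = all? λ e → all? λ f →
    (e ∈? M) →-dec ((f ∈? M) →-dec (¬? (e ≟ f) →-dec
      (¬? (left e ≟ left f) ×-dec ¬? (right e ≟ right f))))

  maxMatchingSize : Subset nE → ℕ
  maxMatchingSize ω =
    max 0 (map ∣_∣ (filter (λ M → (M ⊆? ω) ×-dec isMatching? M) (subsets nE)))

  OPT : ℝ
  OPT = 𝔼 prob (fromℕ ∘ maxMatchingSize)

  Unmatched : Subset nE → Vertex → Set
  Unmatched M v = ∀ f → f ∈ M → ¬ Incident f v

  unmatched? : ∀ M v → Dec (Unmatched M v)
  unmatched? M v = all? λ f → (f ∈? M) →-dec ¬? (incident? f v)

  greedyStep : Subset nE → Subset nE → Edge → Subset nE
  greedyStep ω M e =
    if does (e ∈? ω)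
       ∧ does (unmatched? M (inj₁ (left e)))
       ∧ does (unmatched? M (inj₂ (right e)))
    then M ∪ ⁅ e ⁆
    else M

  -- π ⟨$⟩ʳ i is the i-th edge to arrive.
  greedy : Permutation′ nE → Subset nE → Subset nE
  greedy π ω = foldl (greedyStep ω) ⊥ (tabulate (π ⟨$⟩ʳ_))

  GREEDY : Permutation′ nE → ℝ
  GREEDY π = 𝔼 prob (λ ω → fromℕ ∣ greedy π ω ∣)

  -- w e = - ln (1 - prob e); in particular prob e < 1.
  IsLogNormalizedWeight : (Edge → ℝ) → Set
  IsLogNormalizedWeight w = ∀ e → IsLn (1ℝ - prob e) (- w e)

  weightedDegree : (Edge → ℝ) → Vertex → ℝ
  weightedDegree w v = sum λ e → if does (incident? e v) then w e else 0ℝ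

  IsLogNormalizedRegular : ℝ → Set
  IsLogNormalizedRegular c =
    ∃[ w ] (IsLogNormalizedWeight w × (∀ v → weightedDegree w v ≈ c))

------------------------------------------------------------------------
-- Competitive ratio of GREEDY

IsQuotient : ℝ → ℝ → ℝ → Set
IsQuotient a b r = 0ℝ < b × r * b ≈ a

-- The component Vertex says that the vertex set is nonempty.
GreedyRatio : ℝ → ℝ → Set
GreedyRatio c r =
  Σ[ G ∈ StochasticGraph ] let open StochasticGraph G in
    Vertex ×
    IsLogNormalizedRegular G c ×
    (Σ[ π ∈ Permutation′ nE ] IsQuotient (GREEDY G π) (OPT G) r)

-- Meaningful for c > 0, where every regular graph has OPT > 0.
ρ : ℝ → Upperℝ
ρ c = inf (GreedyRatio c)

{-# OPTIONS --safe #-}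

-- Take m + 1 "hub" and m "leaf" vertices on either side; join every leaf to every
-- hub of the other side, and the i-th left hub to the i-th right hub.  This graph
-- is (m + 1)-regular, so weight c / (m + 1) on each edge makes it c-regular, and
-- for fixed m all edges are realized with probability tending to 1 as c → ∞.
-- Then GREEDY, seeing the hub-hub edges first, stops at m + 1 edges, while
-- matching the leaves into the hubs gives 2 m.
--
-- A real number is handled termwise through its rational approximations.  The
-- probabilities 1 - e^{-w} are represented by 1 - 1 / E k, for E k the partial
-- sums of e^w; the exponential series of -w converges to the limit of 1 / E k
-- because the Cauchy product of the series of e^{-w} and e^w is 1.
module Submission where

open import Data.Bool.Base using (true; false; if_then_else_)
open import Data.Empty using (⊥-elim)
open import Data.Fin.Base
  using (Fin; zero; suc; _↑ˡ_; _↑ʳ_; splitAt; join; combine; remQuot; inject₁)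
import Data.Fin.Permutation as Perm
open import Data.Fin.Properties as Fin
  using ( suc-injective; ↑ˡ-injective; ↑ʳ-injective; inject₁-injective
        ; splitAt-↑ˡ; splitAt-↑ʳ; join-splitAt; remQuot-combine)
open import Data.Fin.Subset using (Subset; inside; outside; _∈_; _⊆_; ⊥; ⊤; ⁅_⁆; _∪_)
  renaming (∣_∣ to ∣_∣ₛ; _-_ to _-ₛ_)
open import Data.Fin.Subset.Properties
  using ( _∈?_; _⊆?_; ∉⊥; ∈⊤; ∣⊥∣≡0; ∣p∣≤n; x∈⁅x⁆; x∈⁅y⁆⇒x≡y; p⊆p∪q; q⊆p∪q; x∈p∪q⁻
        ; p⊆q⇒∣p∣≤∣q∣; x∈p∧x≢y⇒x∈p-y; x∈p⇒∣p-x∣<∣p∣)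
open import Data.Integer.Base as ℤ using (+_)
import Data.Integer.Properties as ℤ
open import Data.List.Base as List using ([]; _∷_; foldl; tabulate; filter)
open import Data.List.Extrema.Nat using (max≤v⁺; v≤max⁺)
import Data.List.Membership.Propositional as List
open import Data.List.Membership.Propositional.Properties
  using (∈-map⁺; ∈-++⁺ˡ; ∈-++⁺ʳ; ∈-filter⁺)
open import Data.List.Properties using (foldl-++)
open import Data.List.Relation.Unary.All as All using (All; []; _∷_)
import Data.List.Relation.Unary.All.Properties as All
import Data.List.Relation.Unary.Any as Any
open import Data.Nat.Base as ℕ using (ℕ; zero; suc; _!)
import Data.Nat.Properties as ℕ
open import Data.Product.Base using (∃-syntax; _×_; _,_; proj₁; proj₂)
open import Data.Rational.Base
open import Data.Rational.Properties
open import Data.Rational.Unnormalised.Base as ℚᵘ using (mkℚᵘ; *≡*; *≤*)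
import Data.Rational.Unnormalised.Properties as ℚᵘ
open import Data.Sum.Base using (_⊎_; inj₁; inj₂; [_,_]′)
import Data.Vec.Base as Vec
import Data.Vec.Functional as Vector
open import Function.Base using (_∘_; id)
open import Level using (0ℓ)
open import Relation.Binary.PropositionalEquality
open import Relation.Nullary using (¬_; Dec; yes; no; does)
open import Relation.Nullary.Decidable using (dec⇒maybe; dec-true; dec-false; _×-dec_)
open import Tactic.RingSolver using (solve-∀)
open import Tactic.RingSolver.Core.AlmostCommutativeRing
  using (AlmostCommutativeRing; fromCommutativeRing)

open import Defs hiding (_+_; _*_; _-_; -_; _^_; _≤_; _<_; sum)
import Defs as Real

-- Regularity dictates the unequal numbers: a leaf meets all m + 1 opposite hubs, a hub only the m
-- opposite leaves, and one hub-hub edge repairs the deficit. These repairing edges cover every hub,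
-- and no edge avoids the hubs, so once taken they leave GREEDY nothing to add. The limsup forces
-- the order of choices: m depends on the tolerance alone, and then a single threshold must serve
-- every larger c. This calls for a quantitative failure bound, and exp(-w) ≤ 1 / (1 + w) is enough:
-- when the weight of an edge is at least the square of the number of edges, randomness shifts each
-- of the two size bounds by at most 1, which is negligible against m. The series of exp(-w) has
-- terms of alternating sign, and its partial sums may leave [0, 1], so they cannot serve as
-- probabilities at each rational approximation. Reciprocals of partial sums of exp(w) can, but the
-- inverse law must then hold uniformly while the approximation to w varies.

ℚ-ring : AlmostCommutativeRing 0ℓ 0ℓ
ℚ-ring = fromCommutativeRing +-*-commutativeRing (λ q → dec⇒maybe (0ℚ ≟ q))

-- Opaque because conversion checking would otherwise unfold the gcd inside _/_.
opaque
  ι : ℕ → ℚ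
  ι n = + n / 1

  ι≡/1 : ∀ n → ι n ≡ + n / 1
  ι≡/1 n = refl

  ι-0 : ι 0 ≡ 0ℚ
  ι-0 = refl

  ι-1 : ι 1 ≡ 1ℚ
  ι-1 = refl

  toℚᵘ-ι : ∀ n → toℚᵘ (ι n) ℚᵘ.≃ mkℚᵘ (+ n) 0
  toℚᵘ-ι n = toℚᵘ-fromℚᵘ (mkℚᵘ (+ n) 0)

ι-homo-+ : ∀ m n → ι (m ℕ.+ n) ≡ ι m + ι n
ι-homo-+ m n = toℚᵘ-injective (begin
  toℚᵘ (ι (m ℕ.+ n))             ≈⟨ toℚᵘ-ι (m ℕ.+ n) ⟩
  mkℚᵘ (+ (m ℕ.+ n)) 0           ≈⟨ *≡* (cong (ℤ._* + 1) (sym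
                                      (cong₂ ℤ._+_ (ℤ.*-identityʳ (+ m)) (ℤ.*-identityʳ (+ n))))) ⟩
  mkℚᵘ (+ m) 0 ℚᵘ.+ mkℚᵘ (+ n) 0 ≈⟨ ℚᵘ.+-cong (toℚᵘ-ι m) (toℚᵘ-ι n) ⟨
  toℚᵘ (ι m) ℚᵘ.+ toℚᵘ (ι n)     ≈⟨ toℚᵘ-homo-+ (ι m) (ι n) ⟨
  toℚᵘ (ι m + ι n)               ∎)
  where open ℚᵘ.≃-Reasoning

ι-homo-* : ∀ m n → ι (m ℕ.* n) ≡ ι m * ι n
ι-homo-* m n = toℚᵘ-injective (begin
  toℚᵘ (ι (m ℕ.* n))             ≈⟨ toℚᵘ-ι (m ℕ.* n) ⟩
  mkℚᵘ (+ (m ℕ.* n)) 0           ≈⟨ *≡* (cong (ℤ._* + 1) (ℤ.pos-* m n)) ⟩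
  mkℚᵘ (+ m) 0 ℚᵘ.* mkℚᵘ (+ n) 0 ≈⟨ ℚᵘ.*-cong (toℚᵘ-ι m) (toℚᵘ-ι n) ⟨
  toℚᵘ (ι m) ℚᵘ.* toℚᵘ (ι n)     ≈⟨ toℚᵘ-homo-* (ι m) (ι n) ⟨
  toℚᵘ (ι m * ι n)               ∎)
  where open ℚᵘ.≃-Reasoning

ι-mono-≤ : ∀ {m n} → m ℕ.≤ n → ι m ≤ ι n
ι-mono-≤ {m} {n} m≤n = toℚᵘ-cancel-≤ (begin
  toℚᵘ (ι m)   ≃⟨ toℚᵘ-ι m ⟩
  mkℚᵘ (+ m) 0 ≤⟨ *≤* (ℤ.*-monoʳ-≤-nonNeg (+ 1) (ℤ.+≤+ m≤n)) ⟩
  mkℚᵘ (+ n) 0 ≃⟨ toℚᵘ-ι n ⟨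
  toℚᵘ (ι n)   ∎)
  where open ℚᵘ.≤-Reasoning

0≤ι : ∀ n → 0ℚ ≤ ι n
0≤ι n = ≤-trans (≤-reflexive (sym ι-0)) (ι-mono-≤ {0} {n} ℕ.z≤n)

ι-suc : ∀ n → ι (suc n) ≡ 1ℚ + ι n
ι-suc n = trans (ι-homo-+ 1 n) (cong (_+ ι n) ι-1)

0<1ℚ : 0ℚ < 1ℚ
0<1ℚ = positive⁻¹ 1ℚ

0<ι-suc : ∀ n → 0ℚ < ι (suc n)
0<ι-suc n = <-≤-trans 0<1ℚ
  (≤-trans (≤-reflexive (sym ι-1)) (ι-mono-≤ {1} {suc n} (ℕ.s≤s ℕ.z≤n)))

-- The absolute value of the numerator serves, because the denominator is at least 1.
archimedean : ∀ q → ∃[ n ] q ≤ ι n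
archimedean q@(mkℚ i d-1 _) = ℤ.∣ i ∣ , toℚᵘ-cancel-≤ (begin
  mkℚᵘ i d-1           ≤⟨ *≤* bound ⟩
  mkℚᵘ (+ ℤ.∣ i ∣) 0   ≃⟨ toℚᵘ-ι ℤ.∣ i ∣ ⟨
  toℚᵘ (ι ℤ.∣ i ∣)     ∎)
  where
  open ℚᵘ.≤-Reasoning
  i≤∣i∣ : ∀ i → i ℤ.≤ + ℤ.∣ i ∣
  i≤∣i∣ (+ _)       = ℤ.≤-refl
  i≤∣i∣ (ℤ.-[1+ _ ]) = ℤ.-≤+
  bound : i ℤ.* + 1 ℤ.≤ + ℤ.∣ i ∣ ℤ.* + suc d-1
  bound = ℤ.≤-trans (ℤ.≤-reflexive (ℤ.*-identityʳ i)) (ℤ.≤-trans (i≤∣i∣ i)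
    (ℤ.≤-trans (ℤ.+≤+ (ℕ.m≤m*n ℤ.∣ i ∣ (suc d-1)))
      (ℤ.≤-reflexive (ℤ.pos-* ℤ.∣ i ∣ (suc d-1)))))

-- Order and absolute value on the rationals

0≤p+q : ∀ {p q} → 0ℚ ≤ p → 0ℚ ≤ q → 0ℚ ≤ p + q
0≤p+q = +-mono-≤

0≤p*q : ∀ {p q} → 0ℚ ≤ p → 0ℚ ≤ q → 0ℚ ≤ p * q
0≤p*q {p} {q} 0≤p 0≤q =
  nonNegative⁻¹ (p * q) {{nonNeg*nonNeg⇒nonNeg p {{nonNegative 0≤p}} q {{nonNegative 0≤q}}}}

p≤q⇒0≤q-p : ∀ {p q} → p ≤ q → 0ℚ ≤ q - p
p≤q⇒0≤q-p {p} {q} p≤q = subst (_≤ q - p) (+-inverseʳ p) (+-monoˡ-≤ (- p) p≤q)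

0≤q-p⇒p≤q : ∀ {p q} → 0ℚ ≤ q - p → p ≤ q
0≤q-p⇒p≤q {p} {q} 0≤q-p = subst₂ _≤_ (+-identityˡ p) (cancel q p) (+-monoˡ-≤ p 0≤q-p)
  where
  cancel : ∀ q p → q - p + p ≡ q
  cancel = solve-∀ ℚ-ring

p≤p+q : ∀ {p q} → 0ℚ ≤ q → p ≤ p + q
p≤p+q {p} {q} 0≤q = subst (_≤ p + q) (+-identityʳ p) (+-monoʳ-≤ p 0≤q)

*-mono-≤ : ∀ {p q r s} → 0ℚ ≤ q → 0ℚ ≤ r → p ≤ q → r ≤ s → p * r ≤ q * s
*-mono-≤ {p} {q} {r} {s} 0≤q 0≤r p≤q r≤s = ≤-trans
  (*-monoʳ-≤-nonNeg r {{nonNegative 0≤r}} p≤q)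
  (*-monoˡ-≤-nonNeg q {{nonNegative 0≤q}} r≤s)

*-cancelˡ-≡ : ∀ r {p q} → 0ℚ < r → r * p ≡ r * q → p ≡ q
*-cancelˡ-≡ r 0<r eq = ≤-antisym
  (*-cancelˡ-≤-pos r {{positive 0<r}} (≤-reflexive eq))
  (*-cancelˡ-≤-pos r {{positive 0<r}} (≤-reflexive (sym eq)))

p≤∣p∣ : ∀ p → p ≤ ∣ p ∣
p≤∣p∣ p with ≤-total 0ℚ p
... | inj₁ 0≤p = ≤-reflexive (sym (0≤p⇒∣p∣≡p 0≤p))
... | inj₂ p≤0 = ≤-trans p≤0 (0≤∣p∣ p)

∣p*q∣≤ : ∀ {p q P Q} → ∣ p ∣ ≤ P → ∣ q ∣ ≤ Q → ∣ p * q ∣ ≤ P * Q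
∣p*q∣≤ {p} {q} p≤P q≤Q = subst (_≤ _) (sym (∣p*q∣≡∣p∣*∣q∣ p q))
  (*-mono-≤ (≤-trans (0≤∣p∣ p) p≤P) (0≤∣p∣ q) p≤P q≤Q)

∣p+q∣≤ : ∀ {p q P Q} → ∣ p ∣ ≤ P → ∣ q ∣ ≤ Q → ∣ p + q ∣ ≤ P + Q
∣p+q∣≤ {p} {q} p≤P q≤Q = ≤-trans (∣p+q∣≤∣p∣+∣q∣ p q) (+-mono-≤ p≤P q≤Q)

-- Lets an estimate be proved in a convenient form and carried back along one ring identity for each
-- side.
∣p∣≤q-resp-≡ : ∀ {p p′ q q′} → p ≡ p′ → q ≡ q′ → ∣ p′ ∣ ≤ q′ → ∣ p ∣ ≤ q
∣p∣≤q-resp-≡ refl refl p≤q = p≤q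

-- Cauchy products

S : (ℕ → ℚ) → ℕ → ℚ
S f zero    = f 0
S f (suc n) = S f n + f (suc n)

S-nonNeg : ∀ {f} → (∀ i → 0ℚ ≤ f i) → ∀ n → 0ℚ ≤ S f n
S-nonNeg 0≤f zero    = 0≤f 0
S-nonNeg 0≤f (suc n) = 0≤p+q (S-nonNeg 0≤f n) (0≤f (suc n))

S-mono : ∀ {f} → (∀ i → 0ℚ ≤ f i) → ∀ {m n} → m ℕ.≤ n → S f m ≤ S f n
S-mono {f} 0≤f m≤n = go (ℕ.≤⇒≤′ m≤n)
  where
  go : ∀ {m n} → m ℕ.≤′ n → S f m ≤ S f n
  go ℕ.≤′-refl       = ≤-refl
  go (ℕ.≤′-step m≤n) = ≤-trans (go m≤n) (p≤p+q (0≤f _))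

∣S∣≤S : ∀ {f F} → (∀ i → ∣ f i ∣ ≤ F i) → ∀ n → ∣ S f n ∣ ≤ S F n
∣S∣≤S f≤F zero    = f≤F 0
∣S∣≤S f≤F (suc n) = ∣p+q∣≤ (∣S∣≤S f≤F n) (f≤F (suc n))

∣S-S∣≤S-S : ∀ {f F} → (∀ i → ∣ f i ∣ ≤ F i) → ∀ {m n} → m ℕ.≤ n →
  ∣ S f n - S f m ∣ ≤ S F n - S F m
∣S-S∣≤S-S {f} {F} f≤F m≤n = go (ℕ.≤⇒≤′ m≤n)
  where
  shift : ∀ p q r → p + q - r ≡ (p - r) + q
  shift = solve-∀ ℚ-ring
  go : ∀ {m n} → m ℕ.≤′ n → ∣ S f n - S f m ∣ ≤ S F n - S F m
  go {m} ℕ.≤′-refl = ∣p∣≤q-resp-≡ (+-inverseʳ (S f m)) (+-inverseʳ (S F m)) ≤-refl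
  go {m} {suc n} (ℕ.≤′-step m≤n) = ∣p∣≤q-resp-≡
    (shift (S f n) (f (suc n)) (S f m)) (shift (S F n) (F (suc n)) (S F m))
    (∣p+q∣≤ (go m≤n) (f≤F (suc n)))

S-suc : ∀ f n → S f (suc n) ≡ f 0 + S (f ∘ suc) n
S-suc f zero    = refl
S-suc f (suc n) = trans (cong (_+ f (suc (suc n))) (S-suc f n)) (+-assoc (f 0) _ _)

-- The sum of f i * g j over i + j = n, written by peeling off i = 0. Only `f` is shifted by the
-- recursion, so the inductions below generalize over `f`.
conv : (ℕ → ℚ) → (ℕ → ℚ) → ℕ → ℚ
conv f g zero    = f 0 * g 0
conv f g (suc n) = f 0 * g (suc n) + conv (f ∘ suc) g n

conv-cong : ∀ {f f′ g g′} → (∀ i → f i ≡ f′ i) → (∀ i → g i ≡ g′ i) →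
  ∀ n → conv f g n ≡ conv f′ g′ n
conv-cong f≡ g≡ zero    = cong₂ _*_ (f≡ 0) (g≡ 0)
conv-cong f≡ g≡ (suc n) =
  cong₂ _+_ (cong₂ _*_ (f≡ 0) (g≡ (suc n))) (conv-cong (f≡ ∘ suc) g≡ n)

conv-nonNeg : ∀ {f g} → (∀ i → 0ℚ ≤ f i) → (∀ i → 0ℚ ≤ g i) → ∀ n → 0ℚ ≤ conv f g n
conv-nonNeg 0≤f 0≤g zero    = 0≤p*q (0≤f 0) (0≤g 0)
conv-nonNeg 0≤f 0≤g (suc n) =
  0≤p+q (0≤p*q (0≤f 0) (0≤g (suc n))) (conv-nonNeg (0≤f ∘ suc) 0≤g n)

conv-scaleˡ : ∀ x f g n → conv (λ i → x * f i) g n ≡ x * conv f g n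
conv-scaleˡ x f g zero    = *-assoc x (f 0) (g 0)
conv-scaleˡ x f g (suc n) = trans
  (cong (λ z → x * f 0 * g (suc n) + z) (conv-scaleˡ x (f ∘ suc) g n))
  (factor x (f 0) (g (suc n)) (conv (f ∘ suc) g n))
  where
  factor : ∀ x a b c → x * a * b + x * c ≡ x * (a * b + c)
  factor = solve-∀ ℚ-ring

conv-scaleʳ : ∀ x f g n → conv f (λ i → x * g i) n ≡ x * conv f g n
conv-scaleʳ x f g zero    = swap (f 0) x (g 0)
  where
  swap : ∀ a x b → a * (x * b) ≡ x * (a * b)
  swap = solve-∀ ℚ-ring
conv-scaleʳ x f g (suc n) = trans
  (cong (λ z → f 0 * (x * g (suc n)) + z) (conv-scaleʳ x (f ∘ suc) g n))
  (factor x (f 0) (g (suc n)) (conv (f ∘ suc) g n))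
  where
  factor : ∀ x a b c → a * (x * b) + x * c ≡ x * (a * b + c)
  factor = solve-∀ ℚ-ring

-- Sorts the triangle i + j ≤ n + 1 by columns: column i = 0 is a full partial sum of `g`, and the
-- remaining columns form the triangle of the shifted `f`.
S-conv-suc : ∀ f g n →
  S (conv f g) (suc n) ≡ f 0 * S g (suc n) + S (conv (f ∘ suc) g) n
S-conv-suc f g zero = regroup (f 0) (g 0) (g 1) (f 1 * g 0)
  where
  regroup : ∀ a b c d → a * b + (a * c + d) ≡ a * (b + c) + d
  regroup = solve-∀ ℚ-ring
S-conv-suc f g (suc n) = trans
  (cong (λ z → z + conv f g (suc (suc n))) (S-conv-suc f g n))
  (regroup (f 0) (S g (suc n)) (g (suc (suc n)))
    (S (conv (f ∘ suc) g) n) (conv (f ∘ suc) g (suc n)))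
  where
  regroup : ∀ a b c d e → a * b + d + (a * c + e) ≡ a * (b + c) + (d + e)
  regroup = solve-∀ ℚ-ring

-- The summands of the rectangle n × k outside the triangle i + j ≤ N are
-- dominated by those of F and G.
rectangle-triangle : ∀ {f g F G} → (∀ i → ∣ f i ∣ ≤ F i) → (∀ i → ∣ g i ∣ ≤ G i) →
  ∀ {N n k} → N ℕ.≤ n → N ℕ.≤ k →
  ∣ S f n * S g k - S (conv f g) N ∣ ≤ S F n * S G k - S (conv F G) N
rectangle-triangle {f} {g} {F} {G} f≤F g≤G {n = n} {k} ℕ.z≤n 0≤k = go n
  where
  factor : ∀ a b c → a * b - a * c ≡ a * (b - c)
  factor = solve-∀ ℚ-ring
  split : ∀ a b c d → (a + d) * b - a * c ≡ a * (b - c) + d * b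
  split = solve-∀ ℚ-ring
  split-S : ∀ f g n →
    S f (suc n) * S g k - f 0 * g 0 ≡ f 0 * (S g k - g 0) + S (f ∘ suc) n * S g k
  split-S f g n = trans (cong (λ z → z * S g k - f 0 * g 0) (S-suc f n))
    (split (f 0) (S g k) (g 0) (S (f ∘ suc) n))
  go : ∀ n → ∣ S f n * S g k - f 0 * g 0 ∣ ≤ S F n * S G k - F 0 * G 0
  go zero = ∣p∣≤q-resp-≡ (factor (f 0) (S g k) (g 0)) (factor (F 0) (S G k) (G 0))
    (∣p*q∣≤ (f≤F 0) (∣S-S∣≤S-S g≤G 0≤k))
  go (suc n) = ∣p∣≤q-resp-≡ (split-S f g n) (split-S F G n)
    (∣p+q∣≤ (∣p*q∣≤ (f≤F 0) (∣S-S∣≤S-S g≤G 0≤k))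
      (∣p*q∣≤ (∣S∣≤S (f≤F ∘ suc) n) (∣S∣≤S g≤G k)))
rectangle-triangle {f} {g} {F} {G} f≤F g≤G {suc N} {suc n} {k} (ℕ.s≤s N≤n) N<k =
  ∣p∣≤q-resp-≡ (split-S f g) (split-S F G)
    (∣p+q∣≤ (∣p*q∣≤ (f≤F 0) (∣S-S∣≤S-S g≤G N<k))
      (rectangle-triangle (f≤F ∘ suc) g≤G N≤n (ℕ.≤-trans (ℕ.n≤1+n N) N<k)))
  where
  split : ∀ a b c d e → (a + d) * b - (a * c + e) ≡ a * (b - c) + (d * b - e)
  split = solve-∀ ℚ-ring
  split-S : ∀ f g →
    S f (suc n) * S g k - S (conv f g) (suc N) ≡
    f 0 * (S g k - S g (suc N)) + (S (f ∘ suc) n * S g k - S (conv (f ∘ suc) g) N)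
  split-S f g = trans
    (cong₂ (λ y z → y * S g k - z) (S-suc f n) (S-conv-suc f g N))
    (split (f 0) (S g k) (S g (suc N)) (S (f ∘ suc) n) (S (conv (f ∘ suc) g) N))

-- Each index pair of the rectangle satisfies i + j ≤ n + k, and the pairs of the triangle outside
-- the rectangle contribute nonnegative terms.
rectangle≤triangle : ∀ {f g} → (∀ i → 0ℚ ≤ f i) → (∀ i → 0ℚ ≤ g i) →
  ∀ n k → S f n * S g k ≤ S (conv f g) (n ℕ.+ k)
rectangle≤triangle 0≤f 0≤g zero zero = ≤-refl
rectangle≤triangle {f} {g} 0≤f 0≤g zero (suc k) = ≤-trans
  (p≤p+q (S-nonNeg (conv-nonNeg (0≤f ∘ suc) 0≤g) k))
  (≤-reflexive (sym (S-conv-suc f g k)))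
rectangle≤triangle {f} {g} 0≤f 0≤g (suc n) k = begin
  S f (suc n) * S g k
    ≡⟨ cong (_* S g k) (S-suc f n) ⟩
  (f 0 + S (f ∘ suc) n) * S g k
    ≡⟨ *-distribʳ-+ (S g k) (f 0) (S (f ∘ suc) n) ⟩
  f 0 * S g k + S (f ∘ suc) n * S g k
    ≤⟨ +-mono-≤
         (*-monoˡ-≤-nonNeg (f 0) {{nonNegative (0≤f 0)}} (S-mono 0≤g (ℕ.m≤n+m k (suc n))))
         (rectangle≤triangle (0≤f ∘ suc) 0≤g n k) ⟩
  f 0 * S g (suc (n ℕ.+ k)) + S (conv (f ∘ suc) g) (n ℕ.+ k)
    ≡⟨ S-conv-suc f g (n ℕ.+ k) ⟨
  S (conv f g) (suc (n ℕ.+ k)) ∎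
  where open ≤-Reasoning

-- On the coefficients of a power series, `θ` is x d/dx and `∂` is d/dx.
θ ∂ : (ℕ → ℚ) → ℕ → ℚ
θ f i = ι i * f i
∂ f i = θ f (suc i)

-- The Leibniz rule for x d/dx; the shift t makes the induction go through.
conv-θ : ∀ t f g n →
  conv (λ i → (ι i + t) * f i) g n + conv f (θ g) n ≡ (ι n + t) * conv f g n
conv-θ t f g zero =
  subst (λ z → (z + t) * f 0 * g 0 + f 0 * (z * g 0) ≡ (z + t) * (f 0 * g 0)) (sym ι-0)
    (base t (f 0) (g 0))
  where
  base : ∀ t a b → (0ℚ + t) * a * b + a * (0ℚ * b) ≡ (0ℚ + t) * (a * b)
  base = solve-∀ ℚ-ring
conv-θ t f g (suc n) = begin
  (ι 0 + t) * f 0 * g (suc n) + conv (λ i → (ι (suc i) + t) * f (suc i)) g n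
    + (f 0 * (ι (suc n) * g (suc n)) + conv (f ∘ suc) (θ g) n)
    ≡⟨ cong₂ (λ y z → (y + t) * f 0 * g (suc n) + z
         + (f 0 * (ι (suc n) * g (suc n)) + conv (f ∘ suc) (θ g) n)) ι-0
       (conv-cong (λ i → cong (_* f (suc i)) (shift i)) (λ _ → refl) n) ⟩
  (0ℚ + t) * f 0 * g (suc n) + conv (λ i → (ι i + (1ℚ + t)) * f (suc i)) g n
    + (f 0 * (ι (suc n) * g (suc n)) + conv (f ∘ suc) (θ g) n)
    ≡⟨ regroup t (f 0) (g (suc n)) (ι (suc n)) _ _ ⟩
  (ι (suc n) + t) * (f 0 * g (suc n))
    + (conv (λ i → (ι i + (1ℚ + t)) * f (suc i)) g n + conv (f ∘ suc) (θ g) n)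
    ≡⟨ cong (λ z → (ι (suc n) + t) * (f 0 * g (suc n)) + z) (conv-θ (1ℚ + t) (f ∘ suc) g n) ⟩
  (ι (suc n) + t) * (f 0 * g (suc n)) + (ι n + (1ℚ + t)) * conv (f ∘ suc) g n
    ≡⟨ cong (λ z → (ι (suc n) + t) * (f 0 * g (suc n)) + z * conv (f ∘ suc) g n) (shift n) ⟨
  (ι (suc n) + t) * (f 0 * g (suc n)) + (ι (suc n) + t) * conv (f ∘ suc) g n
    ≡⟨ *-distribˡ-+ (ι (suc n) + t) _ _ ⟨
  (ι (suc n) + t) * (f 0 * g (suc n) + conv (f ∘ suc) g n) ∎
  where
  open ≡-Reasoning
  assoc : ∀ a b → 1ℚ + a + b ≡ a + (1ℚ + b)
  assoc = solve-∀ ℚ-ring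
  shift : ∀ i → ι (suc i) + t ≡ ι i + (1ℚ + t)
  shift i = trans (cong (_+ t) (ι-suc i)) (assoc (ι i) t)
  regroup : ∀ t a b c d e →
    (0ℚ + t) * a * b + d + (a * (c * b) + e) ≡ (c + t) * (a * b) + (d + e)
  regroup = solve-∀ ℚ-ring

-- As power series, x d/dx g is x times dg/dx: the constant coefficient of `θ g` vanishes and the
-- others move down by one.
conv-θ-suc : ∀ f g n → conv f (θ g) (suc n) ≡ conv f (∂ g) n
conv-θ-suc f g zero =
  trans (cong (λ z → f 0 * (ι 1 * g 1) + f 1 * (z * g 0)) ι-0)
    (base (f 0 * (ι 1 * g 1)) (f 1) (g 0))
  where
  base : ∀ a b c → a + b * (0ℚ * c) ≡ a
  base = solve-∀ ℚ-ring
conv-θ-suc f g (suc n) = cong (λ z → f 0 * ∂ g (suc n) + z) (conv-θ-suc (f ∘ suc) g n)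

-- The product rule for d/dx: `conv-θ` with t = 0 at index n + 1, after cancelling one factor x.
conv-∂ : ∀ f g n → ι (suc n) * conv f g (suc n) ≡ conv (∂ f) g n + conv f (∂ g) n
conv-∂ f g n = begin
  ι (suc n) * conv f g (suc n)
    ≡⟨ cong (_* conv f g (suc n)) (+-identityʳ (ι (suc n))) ⟨
  (ι (suc n) + 0ℚ) * conv f g (suc n)
    ≡⟨ conv-θ 0ℚ f g (suc n) ⟨
  conv (λ i → (ι i + 0ℚ) * f i) g (suc n) + conv f (θ g) (suc n)
    ≡⟨ cong₂ _+_ (conv-cong (λ i → cong (_* f i) (+-identityʳ (ι i))) (λ _ → refl) (suc n))
         (conv-θ-suc f g n) ⟩
  ι 0 * f 0 * g (suc n) + conv (∂ f) g n + conv f (∂ g) n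
    ≡⟨ cong (λ z → z * f 0 * g (suc n) + conv (∂ f) g n + conv f (∂ g) n) ι-0 ⟩
  0ℚ * f 0 * g (suc n) + conv (∂ f) g n + conv f (∂ g) n
    ≡⟨ drop (f 0) (g (suc n)) (conv (∂ f) g n) (conv f (∂ g) n) ⟩
  conv (∂ f) g n + conv f (∂ g) n ∎
  where
  open ≡-Reasoning
  drop : ∀ a b c d → 0ℚ * a * b + c + d ≡ c + d
  drop = solve-∀ ℚ-ring

-- The exponential series

pow : ℚ → ℕ → ℚ
pow q zero    = 1ℚ
pow q (suc k) = q * pow q k

1/! : ℕ → ℚ
1/! k = (+ 1 / (k !)) {{k ℕ.!≢0}}

term : ℚ → ℕ → ℚ
term q k = pow q k * 1/! k

E : ℚ → ℕ → ℚ
E q = S (term q)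

ι*1/ : ∀ n .{{_ : ℕ.NonZero n}} → ι n * (+ 1 / n) ≡ 1ℚ
ι*1/ n@(suc n-1) = toℚᵘ-injective (begin
  toℚᵘ (ι n * (+ 1 / n))            ≈⟨ toℚᵘ-homo-* (ι n) (+ 1 / n) ⟩
  toℚᵘ (ι n) ℚᵘ.* toℚᵘ (+ 1 / n)    ≈⟨ ℚᵘ.*-cong (toℚᵘ-ι n) (toℚᵘ-fromℚᵘ (mkℚᵘ (+ 1) n-1)) ⟩
  mkℚᵘ (+ n) 0 ℚᵘ.* mkℚᵘ (+ 1) n-1  ≈⟨ *≡* (trans (ℤ.*-identityʳ _) (trans (ℤ.*-identityʳ (+ n))
                                         (sym (trans (ℤ.*-identityˡ _) (ℤ.*-identityˡ (+ n)))))) ⟩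
  toℚᵘ 1ℚ                           ∎)
  where open ℚᵘ.≃-Reasoning

ι*1/! : ∀ k → ι (k !) * 1/! k ≡ 1ℚ
ι*1/! k = ι*1/ (k !) {{k ℕ.!≢0}}

1/!-nonNeg : ∀ k → 0ℚ ≤ 1/! k
1/!-nonNeg k = nonNegative⁻¹ _ {{normalize-nonNeg 1 (k !) {{k ℕ.!≢0}}}}

1/!-suc : ∀ k → ι (suc k) * 1/! (suc k) ≡ 1/! k
1/!-suc k = begin
  ι (suc k) * 1/! (suc k)
    ≡⟨ *-identityʳ (ι (suc k) * 1/! (suc k)) ⟨
  ι (suc k) * 1/! (suc k) * 1ℚ
    ≡⟨ cong (λ z → ι (suc k) * 1/! (suc k) * z) (ι*1/! k) ⟨
  ι (suc k) * 1/! (suc k) * (ι (k !) * 1/! k)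
    ≡⟨ regroup (ι (suc k)) (1/! (suc k)) (ι (k !)) (1/! k) ⟩
  ι (suc k) * ι (k !) * 1/! (suc k) * 1/! k
    ≡⟨ cong (λ z → z * 1/! (suc k) * 1/! k) (ι-homo-* (suc k) (k !)) ⟨
  ι (suc k !) * 1/! (suc k) * 1/! k
    ≡⟨ cong (_* 1/! k) (ι*1/! (suc k)) ⟩
  1ℚ * 1/! k
    ≡⟨ *-identityˡ (1/! k) ⟩
  1/! k ∎
  where
  open ≡-Reasoning
  regroup : ∀ a b c d → a * b * (c * d) ≡ a * c * b * d
  regroup = solve-∀ ℚ-ring

-- The differential equation of exp(q x), read off coefficientwise. It is also the recurrence that
-- drives the tail estimates.
∂-term : ∀ q k → ∂ (term q) k ≡ q * term q k
∂-term q k = trans (regroup (ι (suc k)) q (pow q k) (1/! (suc k)))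
  (cong (λ z → q * (pow q k * z)) (1/!-suc k))
  where
  regroup : ∀ a b c d → a * (b * c * d) ≡ b * (c * (a * d))
  regroup = solve-∀ ℚ-ring

∣pow∣≤pow : ∀ {q r} → ∣ q ∣ ≤ r → ∀ k → ∣ pow q k ∣ ≤ pow r k
∣pow∣≤pow q≤r zero    = ≤-refl
∣pow∣≤pow q≤r (suc k) = ∣p*q∣≤ q≤r (∣pow∣≤pow q≤r k)

∣term∣≤term : ∀ {q r} → ∣ q ∣ ≤ r → ∀ k → ∣ term q k ∣ ≤ term r k
∣term∣≤term q≤r k = ∣p*q∣≤ (∣pow∣≤pow q≤r k) (≤-reflexive (0≤p⇒∣p∣≡p (1/!-nonNeg k)))

term-nonNeg : ∀ {q} → 0ℚ ≤ q → ∀ k → 0ℚ ≤ term q k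
term-nonNeg {q} 0≤q k =
  ≤-trans (0≤∣p∣ (term q k)) (∣term∣≤term (≤-reflexive (0≤p⇒∣p∣≡p 0≤q)) k)

-- The binomial theorem without binomial coefficients. By the product rule and `∂-term`, both sides
-- satisfy (k + 1) * a (k + 1) = (x + y) * a k, and both start at 1.
conv-term : ∀ x y k → conv (term x) (term y) k ≡ term (x + y) k
conv-term x y zero    = refl
conv-term x y (suc k) = *-cancelˡ-≡ (ι (suc k)) (0<ι-suc k) (begin
  ι (suc k) * conv (term x) (term y) (suc k)
    ≡⟨ conv-∂ (term x) (term y) k ⟩
  conv (∂ (term x)) (term y) k + conv (term x) (∂ (term y)) k
    ≡⟨ cong₂ _+_
         (trans (conv-cong (∂-term x) (λ _ → refl) k) (conv-scaleˡ x (term x) (term y) k))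
         (trans (conv-cong (λ _ → refl) (∂-term y) k) (conv-scaleʳ y (term x) (term y) k)) ⟩
  x * conv (term x) (term y) k + y * conv (term x) (term y) k
    ≡⟨ *-distribʳ-+ _ x y ⟨
  (x + y) * conv (term x) (term y) k
    ≡⟨ cong ((x + y) *_) (conv-term x y k) ⟩
  (x + y) * term (x + y) k
    ≡⟨ ∂-term (x + y) k ⟨
  ι (suc k) * term (x + y) (suc k) ∎)
  where open ≡-Reasoning

S-cong : ∀ {f g} → (∀ i → f i ≡ g i) → ∀ n → S f n ≡ S g n
S-cong f≡g zero    = f≡g 0
S-cong f≡g (suc n) = cong₂ _+_ (S-cong f≡g n) (f≡g (suc n))

E-0 : ∀ n → E 0ℚ n ≡ 1ℚ
E-0 zero    = refl
E-0 (suc n) = trans (cong₂ _+_ (E-0 n) (zeros (pow 0ℚ n) (1/! (suc n)))) (+-identityʳ 1ℚ)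
  where
  zeros : ∀ a b → 0ℚ * a * b ≡ 0ℚ
  zeros = solve-∀ ℚ-ring

-- The index `suc n` guarantees that the linear term is included; the later terms are nonnegative.
1+q≤E : ∀ {q} → 0ℚ ≤ q → ∀ n → 1ℚ + q ≤ E q (suc n)
1+q≤E {q} 0≤q n = ≤-trans (≤-reflexive (first q))
  (S-mono (term-nonNeg 0≤q) (ℕ.s≤s (ℕ.z≤n {n})))
  where
  first : ∀ q → 1ℚ + q ≡ 1ℚ * 1ℚ + q * 1ℚ * 1ℚ
  first = solve-∀ ℚ-ring

-- By `conv-term` the triangle for -u and u sums to exactly 1, so the error is the rectangle outside
-- the triangle. Replacing -u by u dominates it, and the rectangle for u and u fits into a larger
-- triangle, a partial sum of exp(2u).
E-inverse-error : ∀ {u} → 0ℚ ≤ u → ∀ {N n k} → N ℕ.≤ n → N ℕ.≤ k →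
  ∣ E (- u) n * E u k - 1ℚ ∣ ≤ E (u + u) (n ℕ.+ k) - E (u + u) N
E-inverse-error {u} 0≤u {N} {n} {k} N≤n N≤k = begin
  ∣ E (- u) n * E u k - 1ℚ ∣
    ≡⟨ cong (λ z → ∣ E (- u) n * E u k - z ∣) triangle ⟨
  ∣ E (- u) n * E u k - S (conv (term (- u)) (term u)) N ∣
    ≤⟨ rectangle-triangle (∣term∣≤term (≤-reflexive (trans (∣-p∣≡∣p∣ u) ∣u∣≡u)))
         (∣term∣≤term (≤-reflexive ∣u∣≡u)) N≤n N≤k ⟩
  E u n * E u k - S (conv (term u) (term u)) N
    ≤⟨ +-monoˡ-≤ _ (rectangle≤triangle (term-nonNeg 0≤u) (term-nonNeg 0≤u) n k) ⟩
  S (conv (term u) (term u)) (n ℕ.+ k) - S (conv (term u) (term u)) N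
    ≡⟨ cong₂ _-_ (S-cong (conv-term u u) (n ℕ.+ k)) (S-cong (conv-term u u) N) ⟩
  E (u + u) (n ℕ.+ k) - E (u + u) N ∎
  where
  open ≤-Reasoning
  ∣u∣≡u : ∣ u ∣ ≡ u
  ∣u∣≡u = 0≤p⇒∣p∣≡p 0≤u
  triangle : S (conv (term (- u)) (term u)) N ≡ 1ℚ
  triangle = trans (S-cong (conv-term (- u) u) N)
    (trans (cong (λ z → E z N) (+-inverseˡ u)) (E-0 N))

-- Tails of the exponential series

module Tail (V : ℕ) (0<V : 0ℚ < ι V) where

  V+V : ℕ
  V+V = V ℕ.+ V

  t : ℕ → ℚ
  t = term (ι V)

  t-nonNeg : ∀ i → 0ℚ ≤ t i
  t-nonNeg = term-nonNeg (0≤ι V)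

  -- The ratio of consecutive terms is V / (i + 1), at most one half once i ≥ 2V. The exponent is a
  -- natural number so that 2V can be compared with indices.
  t-halves : ∀ {i} → V+V ℕ.≤ i → t (suc i) + t (suc i) ≤ t i
  t-halves {i} V+V≤i = *-cancelˡ-≤-pos (ι V) {{positive 0<V}} (begin
    ι V * (t (suc i) + t (suc i)) ≡⟨ double (ι V) (t (suc i)) ⟩
    (ι V + ι V) * t (suc i)       ≡⟨ cong (_* t (suc i)) (ι-homo-+ V V) ⟨
    ι V+V * t (suc i)             ≤⟨ *-monoʳ-≤-nonNeg (t (suc i)) {{nonNegative (t-nonNeg (suc i))}}
                                       (ι-mono-≤ (ℕ.m≤n⇒m≤1+n V+V≤i)) ⟩
    ι (suc i) * t (suc i)         ≡⟨ ∂-term (ι V) i ⟩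
    ι V * t i                     ∎)
    where
    open ≤-Reasoning
    double : ∀ a b → a * (b + b) ≡ (a + a) * b
    double = solve-∀ ℚ-ring

  t-bounded : ∀ {i} → V+V ℕ.≤ i → t i ≤ t V+V
  t-bounded V+V≤i = go (ℕ.≤⇒≤′ V+V≤i)
    where
    go : ∀ {i} → V+V ℕ.≤′ i → t i ≤ t V+V
    go ℕ.≤′-refl           = ≤-refl
    go (ℕ.≤′-step {i} V+V≤i) = ≤-trans (p≤p+q (t-nonNeg (suc i)))
      (≤-trans (t-halves (ℕ.≤′⇒≤ V+V≤i)) (go V+V≤i))

  -- From index 2V on, the partial sum plus its last term is nonincreasing: a step changes it by 2 *
  -- t (n + 1) - t n, which is at most 0.
  tail≤term : ∀ {N n} → V+V ℕ.≤ N → N ℕ.≤ n → E (ι V) n - E (ι V) N ≤ t N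
  tail≤term {N} {n} V+V≤N N≤n =
    0≤q-p⇒p≤q (subst (0ℚ ≤_) (regroup (t N) (t n) (E (ι V) n) (E (ι V) N))
      (0≤p+q (p≤q⇒0≤q-p (go (ℕ.≤⇒≤′ N≤n))) (t-nonNeg n)))
    where
    regroup : ∀ a b c d → (d + a) - (c + b) + b ≡ a - (c - d)
    regroup = solve-∀ ℚ-ring
    go : ∀ {n} → N ℕ.≤′ n → E (ι V) n + t n ≤ E (ι V) N + t N
    go ℕ.≤′-refl           = ≤-refl
    go (ℕ.≤′-step {n} N≤n) = ≤-trans
      (≤-trans (≤-reflexive (+-assoc (E (ι V) n) _ _))
        (+-monoʳ-≤ (E (ι V) n) (t-halves (ℕ.≤-trans V+V≤N (ℕ.≤′⇒≤ N≤n)))))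
      (go N≤n)

  -- The recurrence gives N * t N = V * t (N - 1) ≤ V * t (2V), so the tail decays at least like 1 /
  -- N and no powers of one half are needed. `M` is chosen above V * t (2V) / ε.
  tail-small : ∀ ε → 0ℚ < ε → ∃[ N ] (∀ {n} → N ℕ.≤ n → E (ι V) n - E (ι V) N ≤ ε)
  tail-small ε 0<ε with archimedean (ι V * t V+V * (1/ ε) {{pos⇒nonZero ε {{positive 0<ε}}}})
  ... | M , h = suc (V+V ℕ.+ M) , λ N≤n → ≤-trans
    (tail≤term (ℕ.m≤n⇒m≤1+n (ℕ.m≤m+n V+V M)) N≤n)
    (*-cancelˡ-≤-pos (ι (suc (V+V ℕ.+ M))) {{positive (0<ι-suc (V+V ℕ.+ M))}} (begin
      ι (suc (V+V ℕ.+ M)) * t (suc (V+V ℕ.+ M))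
        ≡⟨ ∂-term (ι V) (V+V ℕ.+ M) ⟩
      ι V * t (V+V ℕ.+ M)
        ≤⟨ *-monoˡ-≤-nonNeg (ι V) {{nonNegative (0≤ι V)}} (t-bounded (ℕ.m≤m+n V+V M)) ⟩
      ι V * t V+V
        ≡⟨ *-identityʳ _ ⟨
      ι V * t V+V * 1ℚ
        ≡⟨ cong (λ z → ι V * t V+V * z) (*-inverseˡ ε {{nz}}) ⟨
      ι V * t V+V * ((1/ ε) {{nz}} * ε)
        ≡⟨ *-assoc (ι V * t V+V) _ ε ⟨
      ι V * t V+V * (1/ ε) {{nz}} * ε
        ≤⟨ *-monoʳ-≤-nonNeg ε {{nonNegative (<⇒≤ 0<ε)}}
             (≤-trans h (ι-mono-≤ (ℕ.m≤n⇒m≤1+n (ℕ.m≤n+m M V+V)))) ⟩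
      ι (suc (V+V ℕ.+ M)) * ε ∎))
    where
    open ≤-Reasoning
    nz : NonZero ε
    nz = pos⇒nonZero ε {{positive 0<ε}}

-- Uniformity in u is essential: u will be the k-th approximation to a weight, with k varying.
E-inverse : ∀ B ε → 0ℚ < ε → ∃[ N ] (∀ {u n k} → 0ℚ ≤ u → u ≤ B → N ℕ.≤ n → N ℕ.≤ k →
  ∣ E (- u) n * E u k - 1ℚ ∣ ≤ ε)
E-inverse B ε 0<ε =
  let V , B+B≤V = archimedean (B + B)
      -- All tails of exp(2u) with u ≤ B are dominated by the tail of one series, with a natural
      -- exponent; `suc` makes that exponent positive.
      N , tail  = Tail.tail-small (suc V) (0<ι-suc V) ε 0<ε
  in N , λ {u} {n} {k} 0≤u u≤B N≤n N≤k →
    let N≤n+k   = ℕ.≤-trans N≤n (ℕ.m≤m+n n k)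
        ∣u+u∣≤V = ≤-trans (≤-reflexive (0≤p⇒∣p∣≡p (0≤p+q 0≤u 0≤u)))
                    (≤-trans (+-mono-≤ u≤B u≤B) (≤-trans B+B≤V (ι-mono-≤ (ℕ.n≤1+n V))))
    in ≤-trans (E-inverse-error 0≤u N≤n N≤k)
         (≤-trans (p≤∣p∣ (E (u + u) (n ℕ.+ k) - E (u + u) N))
           (≤-trans (∣S-S∣≤S-S (∣term∣≤term ∣u+u∣≤V) N≤n+k) (tail N≤n+k)))

-- Images and sizes of finite subsets

image : ∀ {k n} → (Fin k → Fin n) → Subset n
image {zero}  f = ⊥
image {suc k} f = ⁅ f zero ⁆ ∪ image (f ∘ suc)

∈-image⁺ : ∀ {k n} (f : Fin k → Fin n) i → f i ∈ image f
∈-image⁺ f zero    = p⊆p∪q (image (f ∘ suc)) (x∈⁅x⁆ (f zero))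
∈-image⁺ f (suc i) = q⊆p∪q ⁅ f zero ⁆ (image (f ∘ suc)) (∈-image⁺ (f ∘ suc) i)

∈-image⁻ : ∀ {k n} (f : Fin k → Fin n) {x} → x ∈ image f → ∃[ i ] f i ≡ x
∈-image⁻ {zero}  f x∈ = ⊥-elim (∉⊥ x∈)
∈-image⁻ {suc k} f x∈ with x∈p∪q⁻ ⁅ f zero ⁆ (image (f ∘ suc)) x∈
... | inj₁ x∈f0 = zero , sym (x∈⁅y⁆⇒x≡y (f zero) x∈f0)
... | inj₂ x∈fs = let i , eq = ∈-image⁻ (f ∘ suc) x∈fs in suc i , eq

-- Deleting `f zero` from `p` lowers its size and, by injectivity, keeps all the other values.
injective⇒≤∣∣ : ∀ {k n} (f : Fin k → Fin n) (p : Subset n) →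
  (∀ i j → f i ≡ f j → i ≡ j) → (∀ i → f i ∈ p) → k ℕ.≤ ∣ p ∣ₛ
injective⇒≤∣∣ {zero}  f p inj f∈p = ℕ.z≤n
injective⇒≤∣∣ {suc k} f p inj f∈p = ℕ.≤-<-trans
  (injective⇒≤∣∣ (f ∘ suc) (p -ₛ f zero)
    (λ i j eq → suc-injective (inj (suc i) (suc j) eq))
    (λ i → x∈p∧x≢y⇒x∈p-y (f∈p (suc i)) (λ eq → 0≢suc (inj zero (suc i) (sym eq)))))
  (x∈p⇒∣p-x∣<∣p∣ (f∈p zero))
  where
  0≢suc : ∀ {i : Fin k} → zero ≢ suc i
  0≢suc ()

∣⊤++⊥∣ : ∀ a b → ∣ ⊤ {a} Vec.++ ⊥ {b} ∣ₛ ≡ a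
∣⊤++⊥∣ zero    b = ∣⊥∣≡0 b
∣⊤++⊥∣ (suc a) b = cong suc (∣⊤++⊥∣ a b)

↑ˡ∈⊤++ : ∀ {a b} (i : Fin a) {q : Subset b} → (i ↑ˡ b) ∈ (⊤ {a} Vec.++ q)
↑ˡ∈⊤++ zero    = Vec.here
↑ˡ∈⊤++ (suc i) = Vec.there (↑ˡ∈⊤++ i)

∈-subsets : ∀ {n} (p : Subset n) → p List.∈ subsets n
∈-subsets Vec.[]              = Any.here refl
∈-subsets (true Vec.∷ p)  = ∈-++⁺ˡ (∈-map⁺ (inside Vec.∷_) (∈-subsets p))
∈-subsets (false Vec.∷ p) =
  ∈-++⁺ʳ (List.map (inside Vec.∷_) (subsets _)) (∈-map⁺ (outside Vec.∷_) (∈-subsets p))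

tabulate-+ : ∀ {A : Set} a {b} (f : Fin (a ℕ.+ b) → A) →
  tabulate f ≡ tabulate (f ∘ (_↑ˡ b)) List.++ tabulate (f ∘ (a ↑ʳ_))
tabulate-+ zero    f = refl
tabulate-+ (suc a) f = cong (f zero ∷_) (tabulate-+ a (f ∘ suc))

-- Matchings and runs of GREEDY in an arbitrary graph

module _ (G : StochasticGraph) where
  open StochasticGraph G

  maxMatchingSize≤nE : ∀ ω → maxMatchingSize G ω ℕ.≤ nE
  maxMatchingSize≤nE ω = max≤v⁺ ℕ.z≤n (All.map⁺ (All.universal ∣p∣≤n
    (filter (λ M → (M ⊆? ω) ×-dec isMatching? G M) (subsets nE))))

  disjoint-edges⇒≤maxMatchingSize : ∀ {k} (f : Fin k → Edge) {ω} →
    (∀ i j → left (f i) ≡ left (f j) → i ≡ j) →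
    (∀ i j → right (f i) ≡ right (f j) → i ≡ j) →
    (∀ i → f i ∈ ω) → k ℕ.≤ maxMatchingSize G ω
  disjoint-edges⇒≤maxMatchingSize f {ω} left-inj right-inj f∈ω = ℕ.≤-trans
    (injective⇒≤∣∣ f M (λ i j eq → left-inj i j (cong left eq)) (∈-image⁺ f))
    (v≤max⁺ 0 _ (inj₂ (Any.map ℕ.≤-reflexive (∈-map⁺ ∣_∣ₛ
      (∈-filter⁺ (λ M → (M ⊆? ω) ×-dec isMatching? G M) (∈-subsets M) (M⊆ω , matching))))))
    where
    M : Subset nE
    M = image f
    M⊆ω : M ⊆ ω
    M⊆ω e∈M = let i , eq = ∈-image⁻ f e∈M in subst (_∈ ω) eq (f∈ω i)
    matching : IsMatching G M
    matching e e′ e∈M e′∈M e≢e′ with ∈-image⁻ f e∈M | ∈-image⁻ f e′∈M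
    ... | i , refl | j , refl =
      (λ eq → e≢e′ (cong f (left-inj i j eq))) , (λ eq → e≢e′ (cong f (right-inj i j eq)))

  Blocked : Subset nE → Edge → Set
  Blocked M e = ∃[ f ] (f ∈ M × (left f ≡ left e ⊎ right f ≡ right e))

  greedyStep-add : ∀ {ω M e} → e ∈ ω → ¬ Blocked M e → greedyStep G ω M e ≡ M ∪ ⁅ e ⁆
  greedyStep-add {ω} {M} {e} e∈ω free
    rewrite dec-true (e ∈? ω) e∈ω
      | dec-true (unmatched? G M (inj₁ (left e))) (λ f f∈M eq → free (f , f∈M , inj₁ eq))
      | dec-true (unmatched? G M (inj₂ (right e))) (λ f f∈M eq → free (f , f∈M , inj₂ eq))
      = refl

  greedyStep-skip : ∀ {ω M e} → Blocked M e → greedyStep G ω M e ≡ M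
  greedyStep-skip {ω} {M} {e} (f , f∈M , inj₁ eq)
    rewrite dec-false (unmatched? G M (inj₁ (left e))) (λ free → free f f∈M eq)
    with does (e ∈? ω)
  ... | true  = refl
  ... | false = refl
  greedyStep-skip {ω} {M} {e} (f , f∈M , inj₂ eq)
    rewrite dec-false (unmatched? G M (inj₂ (right e))) (λ free → free f f∈M eq)
    with does (e ∈? ω) | does (unmatched? G M (inj₁ (left e)))
  ... | true  | true  = refl
  ... | true  | false = refl
  ... | false | _     = refl

  greedy-skips : ∀ {ω M es} → All (Blocked M) es → foldl (greedyStep G ω) M es ≡ M
  greedy-skips [] = refl
  greedy-skips {ω} {M} {e ∷ es} (blocked ∷ rest) =
    trans (cong (λ M → foldl (greedyStep G ω) M es) (greedyStep-skip blocked)) (greedy-skips rest)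

  module _ (D : Subset nE) (D-disjoint : ∀ {e f} → e ∈ D → f ∈ D →
              left f ≡ left e ⊎ right f ≡ right e → f ≡ e) where

    -- An edge of `M` that meets `e` lies in `D` and hence equals `e`. So within `D` a realized edge
    -- is rejected only if it has already been taken.
    greedyStep-disjoint : ∀ {ω M e} → e ∈ ω → M ⊆ D → e ∈ D →
      let M′ = greedyStep G ω M e in M′ ⊆ D × M ⊆ M′ × e ∈ M′
    greedyStep-disjoint {ω} {M} {e} e∈ω M⊆D e∈D with e ∈? M
    ... | yes e∈M rewrite greedyStep-skip {ω} (e , e∈M , inj₁ refl) =
      M⊆D , id , e∈M
    ... | no e∉M rewrite greedyStep-add {ω} {M} {e} e∈ω
          (λ (f , f∈M , meet) → e∉M (subst (_∈ M) (D-disjoint e∈D (M⊆D f∈M) meet) f∈M)) =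
      (λ x∈ → [ M⊆D , (λ x∈e → subst (_∈ D) (sym (x∈⁅y⁆⇒x≡y e x∈e)) e∈D) ]′
                (x∈p∪q⁻ M ⁅ e ⁆ x∈)) ,
      p⊆p∪q ⁅ e ⁆ , q⊆p∪q M ⁅ e ⁆ (x∈⁅x⁆ e)

    greedy-disjoint : ∀ {ω M es} → All (_∈ ω) es → M ⊆ D → All (_∈ D) es →
      let M′ = foldl (greedyStep G ω) M es in M′ ⊆ D × M ⊆ M′ × All (_∈ M′) es
    greedy-disjoint [] M⊆D [] = M⊆D , id , []
    greedy-disjoint (e∈ω ∷ es∈ω) M⊆D (e∈D ∷ es∈D) =
      let M₁⊆D , M⊆M₁ , e∈M₁    = greedyStep-disjoint e∈ω M⊆D e∈D
          M′⊆D , M₁⊆M′ , es∈M′ = greedy-disjoint es∈ω M₁⊆D es∈D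
      in M′⊆D , (λ x∈ → M₁⊆M′ (M⊆M₁ x∈)) , M₁⊆M′ e∈M₁ ∷ es∈M′

-- Finite sums of rationals

sumℚ : ∀ {n} → (Fin n → ℚ) → ℚ
sumℚ = Vector.foldr _+_ 0ℚ

seq-sum : ∀ {n} (f : Fin n → ℝ) k → seq (Real.sum f) k ≡ sumℚ (λ i → seq (f i) k)
seq-sum {zero}  f k = refl
seq-sum {suc n} f k = cong (λ z → seq (f zero) k + z) (seq-sum (f ∘ suc) k)

sumℚ-cong : ∀ {n} {f g : Fin n → ℚ} → (∀ i → f i ≡ g i) → sumℚ f ≡ sumℚ g
sumℚ-cong {zero}  f≡g = refl
sumℚ-cong {suc n} f≡g = cong₂ _+_ (f≡g zero) (sumℚ-cong (f≡g ∘ suc))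

sumℚ-+ : ∀ a {b} (f : Fin (a ℕ.+ b) → ℚ) →
  sumℚ f ≡ sumℚ (f ∘ (_↑ˡ b)) + sumℚ (f ∘ (a ↑ʳ_))
sumℚ-+ zero    f = sym (+-identityˡ _)
sumℚ-+ (suc a) f = trans (cong (λ z → f zero + z) (sumℚ-+ a (f ∘ suc)))
  (sym (+-assoc (f zero) _ _))

sumℚ-* : ∀ a {b} (f : Fin (a ℕ.* b) → ℚ) →
  sumℚ f ≡ sumℚ {a} (λ i → sumℚ {b} (λ j → f (combine i j)))
sumℚ-* zero        f = refl
sumℚ-* (suc a) {b} f = trans (sumℚ-+ b f)
  (cong (λ z → sumℚ (f ∘ (_↑ˡ (a ℕ.* b))) + z) (sumℚ-* a (f ∘ (b ↑ʳ_))))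

sumℚ-const : ∀ n x → sumℚ {n} (λ _ → x) ≡ ι n * x
sumℚ-const zero    x = trans (sym (*-zeroˡ x)) (cong (_* x) (sym ι-0))
sumℚ-const (suc n) x = begin
  x + sumℚ {n} (λ _ → x)      ≡⟨ cong₂ _+_ (sym (*-identityˡ x)) (sumℚ-const n x) ⟩
  1ℚ * x + ι n * x        ≡⟨ *-distribʳ-+ x 1ℚ (ι n) ⟨
  (1ℚ + ι n) * x            ≡⟨ cong (_* x) (ι-suc n) ⟨
  ι (suc n) * x               ∎
  where open ≡-Reasoning

sumℚ-scale : ∀ {n} y (f : Fin n → ℚ) → sumℚ (λ i → y * f i) ≡ y * sumℚ f
sumℚ-scale {zero}  y f = sym (*-zeroʳ y)
sumℚ-scale {suc n} y f = trans (cong (λ z → y * f zero + z) (sumℚ-scale y (f ∘ suc)))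
  (sym (*-distribˡ-+ y (f zero) _))

sumℚ-0 : ∀ n → sumℚ {n} (λ _ → 0ℚ) ≡ 0ℚ
sumℚ-0 n = trans (sumℚ-const n 0ℚ) (*-zeroʳ (ι n))

module _ (x : ℚ) where

  χ : ∀ {P : Set} → Dec P → ℚ
  χ P? = if does P? then x else 0ℚ

  χ-cong : ∀ {P Q : Set} → (P → Q) → (Q → P) → ∀ (P? : Dec P) (Q? : Dec Q) → χ P? ≡ χ Q?
  χ-cong P→Q Q→P (yes p) Q? rewrite dec-true Q? (P→Q p) = refl
  χ-cong P→Q Q→P (no ¬p) Q? rewrite dec-false Q? (¬p ∘ Q→P) = refl

  χ-false : ∀ {P : Set} → ¬ P → ∀ (P? : Dec P) → χ P? ≡ 0ℚ
  χ-false ¬p P? rewrite dec-false P? ¬p = refl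

  sum-χ-≟ : ∀ {n} (u : Fin n) → sumℚ (λ i → χ (i Fin.≟ u)) ≡ x
  sum-χ-≟ {suc n} zero = trans (cong (λ z → x + z)
    (trans (sumℚ-cong {n} (λ i → χ-false (λ ()) (suc i Fin.≟ zero))) (sumℚ-0 n))) (+-identityʳ x)
  sum-χ-≟ {suc n} (suc u) = trans (+-identityˡ _) (trans
    (sumℚ-cong {n} (λ i → χ-cong suc-injective (cong suc) (suc i Fin.≟ suc u) (i Fin.≟ u)))
    (sum-χ-≟ u))

-- The hub-and-leaf graph

↑ˡ≢↑ʳ : ∀ {a b} (i : Fin a) (j : Fin b) → i ↑ˡ b ≢ a ↑ʳ j
↑ˡ≢↑ʳ (suc i) j eq = ↑ˡ≢↑ʳ i j (suc-injective eq)

-- Given apart from the graph because the threshold for c involves the number of edges, while the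
-- graph itself depends on c through its probabilities.
edgeCount : ℕ → ℕ
edgeCount m = suc m ℕ.+ (m ℕ.* suc m ℕ.+ m ℕ.* suc m)

module Family (m : ℕ) (p : ℝ) (0≤p : 0ℝ Real.≤ p) (p≤1 : p Real.≤ 1ℝ) where

  n nE₂ : ℕ
  n   = suc m ℕ.+ m
  nE₂ = m ℕ.* suc m

  -- On each side the hubs are numbered before the leaves. An index below m * (m + 1) encodes a leaf
  -- as its quotient and a hub as its remainder.
  hub : Fin nE₂ → Fin n
  hub e = proj₂ (remQuot {m} (suc m) e) ↑ˡ m

  leaf : Fin nE₂ → Fin n
  leaf e = suc m ↑ʳ proj₁ (remQuot {m} (suc m) e)

  -- The numbering of the edges doubles as the arrival order `Perm.id`: the hub-hub block comes
  -- first, then the edges with their leaf on the left, then those with their leaf on the right.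
  G : StochasticGraph
  G = record
    { nL     = n
    ; nR     = n
    ; nE     = suc m ℕ.+ (nE₂ ℕ.+ nE₂)
    ; left   = λ e → [ _↑ˡ m , [ leaf , hub ]′ ∘ splitAt nE₂ ]′ (splitAt (suc m) e)
    ; right  = λ e → [ _↑ˡ m , [ hub , leaf ]′ ∘ splitAt nE₂ ]′ (splitAt (suc m) e)
    ; prob   = λ _ → p
    ; 0≤prob = λ _ → 0≤p
    ; prob≤1 = λ _ → p≤1
    }

  open StochasticGraph G using (Edge; nE; left; right)

  diagonal : Fin (suc m) → Edge
  diagonal i = i ↑ˡ (nE₂ ℕ.+ nE₂)

  leafEdgeL leafEdgeR : Fin nE₂ → Edge
  leafEdgeL e = suc m ↑ʳ (e ↑ˡ nE₂)
  leafEdgeR e = suc m ↑ʳ (nE₂ ↑ʳ e)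

  module _ (i : Fin (suc m)) where
    left-diagonal : left (diagonal i) ≡ i ↑ˡ m
    left-diagonal rewrite splitAt-↑ˡ (suc m) i (nE₂ ℕ.+ nE₂) = refl

    right-diagonal : right (diagonal i) ≡ i ↑ˡ m
    right-diagonal rewrite splitAt-↑ˡ (suc m) i (nE₂ ℕ.+ nE₂) = refl

  module _ (e : Fin nE₂) where
    left-leafEdgeL : left (leafEdgeL e) ≡ leaf e
    left-leafEdgeL rewrite splitAt-↑ʳ (suc m) (nE₂ ℕ.+ nE₂) (e ↑ˡ nE₂) | splitAt-↑ˡ nE₂ e nE₂ = refl

    right-leafEdgeL : right (leafEdgeL e) ≡ hub e
    right-leafEdgeL rewrite splitAt-↑ʳ (suc m) (nE₂ ℕ.+ nE₂) (e ↑ˡ nE₂) | splitAt-↑ˡ nE₂ e nE₂ = refl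

    left-leafEdgeR : left (leafEdgeR e) ≡ hub e
    left-leafEdgeR rewrite splitAt-↑ʳ (suc m) (nE₂ ℕ.+ nE₂) (nE₂ ↑ʳ e) | splitAt-↑ʳ nE₂ nE₂ e = refl

    right-leafEdgeR : right (leafEdgeR e) ≡ leaf e
    right-leafEdgeR rewrite splitAt-↑ʳ (suc m) (nE₂ ℕ.+ nE₂) (nE₂ ↑ʳ e) | splitAt-↑ʳ nE₂ nE₂ e = refl

  hub-combine : ∀ j i → hub (combine j i) ≡ i ↑ˡ m
  hub-combine j i = cong (λ z → proj₂ z ↑ˡ m) (remQuot-combine {m} j i)

  leaf-combine : ∀ j i → leaf (combine j i) ≡ suc m ↑ʳ j
  leaf-combine j i = cong (λ z → suc m ↑ʳ proj₁ z) (remQuot-combine {m} j i)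

  D : Subset nE
  D = ⊤ {suc m} Vec.++ ⊥ {nE₂ ℕ.+ nE₂}

  ∈D⇒diagonal : ∀ {e} → e ∈ D → ∃[ i ] diagonal i ≡ e
  ∈D⇒diagonal = go (suc m)
    where
    go : ∀ a {b} {e : Fin (a ℕ.+ b)} → e ∈ (⊤ {a} Vec.++ ⊥ {b}) → ∃[ i ] i ↑ˡ b ≡ e
    go zero    e∈            = ⊥-elim (∉⊥ e∈)
    go (suc a) Vec.here      = zero , refl
    go (suc a) (Vec.there e∈) = let i , eq = go a e∈ in suc i , cong suc eq

  D-disjoint : ∀ {e f} → e ∈ D → f ∈ D → left f ≡ left e ⊎ right f ≡ right e → f ≡ e
  D-disjoint e∈D f∈D meet with ∈D⇒diagonal e∈D | ∈D⇒diagonal f∈D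
  ... | i , refl | j , refl = cong diagonal (↑ˡ-injective m j i (endpoints meet))
    where
    endpoints : left (diagonal j) ≡ left (diagonal i) ⊎ right (diagonal j) ≡ right (diagonal i) →
      j ↑ˡ m ≡ i ↑ˡ m
    endpoints (inj₁ eq) = trans (sym (left-diagonal j)) (trans eq (left-diagonal i))
    endpoints (inj₂ eq) = trans (sym (right-diagonal j)) (trans eq (right-diagonal i))

  -- The first block is a matching and is taken entirely. It covers all hubs, and every later edge
  -- has a hub as an endpoint.
  ∣greedy∣≤ : ∣ greedy G Perm.id ⊤ ∣ₛ ℕ.≤ suc m
  ∣greedy∣≤ = begin
    ∣ foldl step ⊥ (tabulate id) ∣ₛ
      ≡⟨ cong (λ es → ∣ foldl step ⊥ es ∣ₛ) (tabulate-+ (suc m) id) ⟩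
    ∣ foldl step ⊥ (tabulate diagonal List.++ tabulate (suc m ↑ʳ_)) ∣ₛ
      ≡⟨ cong ∣_∣ₛ (foldl-++ step ⊥ (tabulate diagonal) _) ⟩
    ∣ foldl step M (tabulate (suc m ↑ʳ_)) ∣ₛ
      ≡⟨ cong ∣_∣ₛ (greedy-skips G (All.tabulate⁺ blocked)) ⟩
    ∣ M ∣ₛ
      ≤⟨ p⊆q⇒∣p∣≤∣q∣ (proj₁ phase₁) ⟩
    ∣ D ∣ₛ
      ≡⟨ ∣⊤++⊥∣ (suc m) (nE₂ ℕ.+ nE₂) ⟩
    suc m ∎
    where
    open ℕ.≤-Reasoning
    step : Subset nE → Edge → Subset nE
    step = greedyStep G ⊤
    M : Subset nE
    M = foldl step ⊥ (tabulate diagonal)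
    phase₁ : M ⊆ D × ⊥ ⊆ M × All (_∈ M) (tabulate diagonal)
    phase₁ = greedy-disjoint G D D-disjoint (All.universal (λ _ → ∈⊤) _)
      (λ x∈⊥ → ⊥-elim (∉⊥ x∈⊥)) (All.tabulate⁺ (λ i → ↑ˡ∈⊤++ i))
    diagonal∈M : ∀ i → diagonal i ∈ M
    diagonal∈M = All.tabulate⁻ (proj₂ (proj₂ phase₁))
    blocked : ∀ e → Blocked G M (suc m ↑ʳ e)
    blocked e with splitAt nE₂ e | join-splitAt nE₂ nE₂ e
    ... | inj₁ e′ | refl = diagonal i , diagonal∈M i ,
      inj₂ (trans (right-diagonal i) (sym (right-leafEdgeL e′)))
      where i = proj₂ (remQuot {m} (suc m) e′)
    ... | inj₂ e′ | refl = diagonal i , diagonal∈M i ,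
      inj₁ (trans (left-diagonal i) (sym (left-leafEdgeR e′)))
      where i = proj₂ (remQuot {m} (suc m) e′)

  -- The j-th leaf of either side is matched to the j-th hub opposite; `inject₁` leaves out the last
  -- hub of each side.
  ≤maxMatchingSize : m ℕ.+ m ℕ.≤ maxMatchingSize G ⊤
  ≤maxMatchingSize = disjoint-edges⇒≤maxMatchingSize G (edge ∘ splitAt m)
    (λ i j eq → splitAt-injective (left-inj _ _ (trans (sym (left-edge (splitAt m i)))
      (trans eq (left-edge (splitAt m j))))))
    (λ i j eq → splitAt-injective (right-inj _ _ (trans (sym (right-edge (splitAt m i)))
      (trans eq (right-edge (splitAt m j))))))
    (λ _ → ∈⊤)
    where
    edge : Fin m ⊎ Fin m → Edge
    edge (inj₁ j) = leafEdgeL (combine j (inject₁ j))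
    edge (inj₂ j) = leafEdgeR (combine j (inject₁ j))
    leftEnd rightEnd : Fin m ⊎ Fin m → Fin n
    leftEnd (inj₁ j) = suc m ↑ʳ j
    leftEnd (inj₂ j) = inject₁ j ↑ˡ m
    rightEnd (inj₁ j) = inject₁ j ↑ˡ m
    rightEnd (inj₂ j) = suc m ↑ʳ j
    left-edge : ∀ x → left (edge x) ≡ leftEnd x
    left-edge (inj₁ j) = trans (left-leafEdgeL _) (leaf-combine j (inject₁ j))
    left-edge (inj₂ j) = trans (left-leafEdgeR _) (hub-combine j (inject₁ j))
    right-edge : ∀ x → right (edge x) ≡ rightEnd x
    right-edge (inj₁ j) = trans (right-leafEdgeL _) (hub-combine j (inject₁ j))
    right-edge (inj₂ j) = trans (right-leafEdgeR _) (leaf-combine j (inject₁ j))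
    left-inj : ∀ x y → leftEnd x ≡ leftEnd y → x ≡ y
    left-inj (inj₁ i) (inj₁ j) eq = cong inj₁ (↑ʳ-injective (suc m) i j eq)
    left-inj (inj₁ i) (inj₂ j) eq = ⊥-elim (↑ˡ≢↑ʳ (inject₁ j) i (sym eq))
    left-inj (inj₂ i) (inj₁ j) eq = ⊥-elim (↑ˡ≢↑ʳ (inject₁ i) j eq)
    left-inj (inj₂ i) (inj₂ j) eq = cong inj₂ (inject₁-injective (↑ˡ-injective m _ _ eq))
    right-inj : ∀ x y → rightEnd x ≡ rightEnd y → x ≡ y
    right-inj (inj₁ i) (inj₁ j) eq = cong inj₁ (inject₁-injective (↑ˡ-injective m _ _ eq))
    right-inj (inj₁ i) (inj₂ j) eq = ⊥-elim (↑ˡ≢↑ʳ (inject₁ i) j eq)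
    right-inj (inj₂ i) (inj₁ j) eq = ⊥-elim (↑ˡ≢↑ʳ (inject₁ j) i (sym eq))
    right-inj (inj₂ i) (inj₂ j) eq = cong inj₂ (↑ʳ-injective (suc m) i j eq)
    splitAt-injective : ∀ {i j} → splitAt m i ≡ splitAt m j → i ≡ j
    splitAt-injective {i} {j} eq = trans (sym (join-splitAt m m i))
      (trans (cong (join m m) eq) (join-splitAt m m j))

  module _ (x : ℚ) where

    diagonalSum hubSum leafSum : Fin n → ℚ
    diagonalSum u = sumℚ (λ i → χ x ((i ↑ˡ m) Fin.≟ u))
    hubSum      u = sumℚ (λ e → χ x (hub e Fin.≟ u))
    leafSum     u = sumℚ (λ e → χ x (leaf e Fin.≟ u))

    sum-by-block : ∀ (end : Edge → Fin n) (f g : Fin nE₂ → Fin n) →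
      (∀ i → end (diagonal i) ≡ i ↑ˡ m) →
      (∀ e → end (leafEdgeL e) ≡ f e) → (∀ e → end (leafEdgeR e) ≡ g e) → ∀ u →
      sumℚ (λ e → χ x (end e Fin.≟ u)) ≡
      diagonalSum u + (sumℚ (λ e → χ x (f e Fin.≟ u)) + sumℚ (λ e → χ x (g e Fin.≟ u)))
    sum-by-block end f g end-d end-l end-r u = trans
      (sumℚ-+ (suc m) (λ e → χ x (end e Fin.≟ u))) (cong₂ _+_
      (sumℚ-cong (λ i → cong (λ v → χ x (v Fin.≟ u)) (end-d i)))
      (trans (sumℚ-+ nE₂ (λ e → χ x (end (suc m ↑ʳ e) Fin.≟ u))) (cong₂ _+_
        (sumℚ-cong (λ e → cong (λ v → χ x (v Fin.≟ u)) (end-l e)))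
        (sumℚ-cong (λ e → cong (λ v → χ x (v Fin.≟ u)) (end-r e))))))

    -- For each of the m leaves, the edges to the opposite hubs run through all hubs once, just as
    -- the hub-hub edges do.
    hubSum≡ : ∀ u → hubSum u ≡ sumℚ {m} (λ _ → diagonalSum u)
    hubSum≡ u = trans (sumℚ-* m (λ e → χ x (hub e Fin.≟ u))) (sumℚ-cong (λ j → sumℚ-cong (λ i →
      cong (λ v → χ x (v Fin.≟ u)) (hub-combine j i))))

    leafSum≡ : ∀ u → leafSum u ≡ sumℚ {m} (λ j → sumℚ {suc m} (λ _ → χ x ((suc m ↑ʳ j) Fin.≟ u)))
    leafSum≡ u = trans (sumℚ-* m (λ e → χ x (leaf e Fin.≟ u))) (sumℚ-cong (λ j → sumℚ-cong (λ i →
      cong (λ v → χ x (v Fin.≟ u)) (leaf-combine j i))))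

    diagonalSum-↑ˡ : ∀ i → diagonalSum (i ↑ˡ m) ≡ x
    diagonalSum-↑ˡ i = trans
      (sumℚ-cong (λ i′ → χ-cong x (↑ˡ-injective m i′ i) (cong (_↑ˡ m))
        (i′ ↑ˡ m Fin.≟ i ↑ˡ m) (i′ Fin.≟ i)))
      (sum-χ-≟ x i)

    diagonalSum-↑ʳ : ∀ j → diagonalSum (suc m ↑ʳ j) ≡ 0ℚ
    diagonalSum-↑ʳ j = trans
      (sumℚ-cong (λ i → χ-false x (↑ˡ≢↑ʳ i j) ((i ↑ˡ m) Fin.≟ (suc m ↑ʳ j)))) (sumℚ-0 (suc m))

    leafSum-↑ˡ : ∀ i → leafSum (i ↑ˡ m) ≡ 0ℚ
    leafSum-↑ˡ i = trans (leafSum≡ (i ↑ˡ m)) (trans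
      (sumℚ-cong (λ j → trans
        (sumℚ-cong {suc m} (λ _ → χ-false x (↑ˡ≢↑ʳ i j ∘ sym) ((suc m ↑ʳ j) Fin.≟ (i ↑ˡ m))))
        (sumℚ-0 (suc m))))
      (sumℚ-0 m))

    leafSum-↑ʳ : ∀ j → leafSum (suc m ↑ʳ j) ≡ ι (suc m) * x
    leafSum-↑ʳ j = begin
      leafSum (suc m ↑ʳ j)
        ≡⟨ leafSum≡ (suc m ↑ʳ j) ⟩
      sumℚ {m} (λ j′ → sumℚ {suc m} (λ _ → χ x ((suc m ↑ʳ j′) Fin.≟ (suc m ↑ʳ j))))
        ≡⟨ sumℚ-cong (λ j′ → trans (sumℚ-const (suc m) _) (cong (ι (suc m) *_)
             (χ-cong x (↑ʳ-injective (suc m) j′ j) (cong (suc m ↑ʳ_))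
               ((suc m ↑ʳ j′) Fin.≟ (suc m ↑ʳ j)) (j′ Fin.≟ j)))) ⟩
      sumℚ {m} (λ j′ → ι (suc m) * χ x (j′ Fin.≟ j))
        ≡⟨ sumℚ-scale (ι (suc m)) (λ j′ → χ x (j′ Fin.≟ j)) ⟩
      ι (suc m) * sumℚ {m} (λ j′ → χ x (j′ Fin.≟ j))
        ≡⟨ cong (ι (suc m) *_) (sum-χ-≟ x j) ⟩
      ι (suc m) * x ∎
      where open ≡-Reasoning

    -- A hub has one hub-hub edge and m leaf edges; a leaf has m + 1 hub edges and nothing else.
    degree : ∀ u → diagonalSum u + (hubSum u + leafSum u) ≡ ι (suc m) * x
    degree u with splitAt (suc m) u | join-splitAt (suc m) m u
    ... | inj₁ i | refl = begin
      diagonalSum (i ↑ˡ m) + (hubSum (i ↑ˡ m) + leafSum (i ↑ˡ m))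
        ≡⟨ cong₂ (λ y z → diagonalSum (i ↑ˡ m) + (y + z)) (hubSum≡ (i ↑ˡ m)) (leafSum-↑ˡ i) ⟩
      diagonalSum (i ↑ˡ m) + (sumℚ {m} (λ _ → diagonalSum (i ↑ˡ m)) + 0ℚ)
        ≡⟨ cong (λ z → diagonalSum (i ↑ˡ m) + z) (+-identityʳ _) ⟩
      -- The hub-hub term and the m copies of it are, by definition, a sum of m + 1 copies.
      sumℚ {suc m} (λ _ → diagonalSum (i ↑ˡ m))
        ≡⟨ sumℚ-const (suc m) _ ⟩
      ι (suc m) * diagonalSum (i ↑ˡ m)
        ≡⟨ cong (ι (suc m) *_) (diagonalSum-↑ˡ i) ⟩
      ι (suc m) * x ∎
      where open ≡-Reasoning
    ... | inj₂ j | refl = begin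
      diagonalSum (suc m ↑ʳ j) + (hubSum (suc m ↑ʳ j) + leafSum (suc m ↑ʳ j))
        ≡⟨ cong₂ (λ y z → y + (z + leafSum (suc m ↑ʳ j))) (diagonalSum-↑ʳ j)
             (trans (hubSum≡ (suc m ↑ʳ j))
               (trans (sumℚ-cong {m} (λ _ → diagonalSum-↑ʳ j)) (sumℚ-0 m))) ⟩
      0ℚ + (0ℚ + leafSum (suc m ↑ʳ j))
        ≡⟨ trans (+-identityˡ _) (+-identityˡ _) ⟩
      leafSum (suc m ↑ʳ j)
        ≡⟨ leafSum-↑ʳ j ⟩
      ι (suc m) * x ∎
      where open ≡-Reasoning

  seq-if : ∀ b w k → seq (if b then w else 0ℝ) k ≡ (if b then seq w k else 0ℚ)
  seq-if true  w k = refl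
  seq-if false w k = refl

  weightedDegree≡ : ∀ (w : ℝ) v k →
    seq (weightedDegree G (λ _ → w) v) k ≡ ι (suc m) * seq w k
  weightedDegree≡ w (inj₁ u) k = trans
    (seq-sum (λ e → if does (left e Fin.≟ u) then w else 0ℝ) k) (trans
    (sumℚ-cong (λ e → seq-if (does (left e Fin.≟ u)) w k))
    (trans (sum-by-block (seq w k) left leaf hub left-diagonal left-leafEdgeL left-leafEdgeR u)
      (trans (cong (λ z → diagonalSum (seq w k) u + z)
        (+-comm (leafSum (seq w k) u) (hubSum (seq w k) u))) (degree (seq w k) u))))
  weightedDegree≡ w (inj₂ v) k = trans
    (seq-sum (λ e → if does (right e Fin.≟ v) then w else 0ℝ) k) (trans
    (sumℚ-cong (λ e → seq-if (does (right e Fin.≟ v)) w k))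
    (trans (sum-by-block (seq w k) right hub leaf right-diagonal right-leafEdgeL right-leafEdgeR v)
      (degree (seq w k) v)))

-- Reciprocals of rationals that are at least 1

recip : ∀ q → 1ℚ ≤ q → ℚ
recip q 1≤q = (1/ q) {{pos⇒nonZero q {{positive (<-≤-trans 0<1ℚ 1≤q)}}}}

module _ {q : ℚ} (1≤q : 1ℚ ≤ q) where

  private
    0<q : 0ℚ < q
    0<q = <-≤-trans 0<1ℚ 1≤q

  *-recip : q * recip q 1≤q ≡ 1ℚ
  *-recip = *-inverseʳ q {{pos⇒nonZero q {{positive 0<q}}}}

  0≤recip : 0ℚ ≤ recip q 1≤q
  0≤recip = <⇒≤ (positive⁻¹ (recip q 1≤q) {{1/pos⇒pos q {{positive 0<q}}}})

  recip*≤1 : ∀ {p} → p ≤ q → recip q 1≤q * p ≤ 1ℚ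
  recip*≤1 {p} p≤q = ≤-trans
    (*-monoˡ-≤-nonNeg (recip q 1≤q) {{nonNegative 0≤recip}} p≤q)
    (≤-reflexive (trans (*-comm (recip q 1≤q) q) *-recip))

  recip≤1 : recip q 1≤q ≤ 1ℚ
  recip≤1 = ≤-trans (≤-reflexive (sym (*-identityʳ (recip q 1≤q)))) (recip*≤1 1≤q)

  ∣recip∣≤1 : ∣ recip q 1≤q ∣ ≤ 1ℚ
  ∣recip∣≤1 = ≤-trans (≤-reflexive (0≤p⇒∣p∣≡p 0≤recip)) recip≤1

  -- Since p - 1/q = (p * q - 1) / q, dividing by q ≥ 1 does not enlarge the error.
  ∣p-recip∣≤ : ∀ p {ε} → ∣ p * q - 1ℚ ∣ ≤ ε → ∣ p - recip q 1≤q ∣ ≤ ε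
  ∣p-recip∣≤ p {ε} h = ∣p∣≤q-resp-≡
    (trans (cong (λ z → z - recip q 1≤q) (trans (sym (*-identityʳ p)) (cong (p *_) (sym *-recip))))
      (factor p q (recip q 1≤q)))
    (sym (*-identityʳ ε)) (∣p*q∣≤ h ∣recip∣≤1)
    where
    factor : ∀ p q r → p * (q * r) - r ≡ (p * q - 1ℚ) * r
    factor = solve-∀ ℚ-ring

-- The reciprocal is 1-Lipschitz on [1, ∞), so termwise reciprocals preserve Cauchy sequences.
∣recip-recip∣≤ : ∀ {p q} (1≤p : 1ℚ ≤ p) (1≤q : 1ℚ ≤ q) →
  ∣ recip p 1≤p - recip q 1≤q ∣ ≤ ∣ p - q ∣
∣recip-recip∣≤ {p} {q} 1≤p 1≤q = ∣p-recip∣≤ 1≤q (recip p 1≤p) (∣p∣≤q-resp-≡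
  (trans (cong (λ z → recip p 1≤p * q - z) (sym (*-recip 1≤p)))
    (factor (recip p 1≤p) p q))
  (trans (trans (sym (∣-p∣≡∣p∣ (p - q))) (cong ∣_∣ (swap p q))) (sym (*-identityˡ ∣ q - p ∣)))
  (∣p*q∣≤ (∣recip∣≤1 1≤p) ≤-refl))
  where
  factor : ∀ r p q → r * q - p * r ≡ r * (q - p)
  factor = solve-∀ ℚ-ring
  swap : ∀ p q → - (p - q) ≡ q - p
  swap = solve-∀ ℚ-ring

-- Real numbers

≗⇒≈ : ∀ {x y} → (∀ k → seq x k ≡ seq y k) → x ≈ y
≗⇒≈ {x} {y} x≡y ε 0<ε = 0 , λ k _ →
  ∣p∣≤q-resp-≡ (trans (cong (λ z → z - seq y k) (x≡y k)) (+-inverseʳ (seq y k))) refl (<⇒≤ 0<ε)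

pointwise⇒≤ : ∀ {x y} → (∀ k → seq x k ≤ seq y k) → x Real.≤ y
pointwise⇒≤ x≤y ε 0<ε = 0 , λ k _ → ≤-trans (x≤y k) (p≤p+q (<⇒≤ 0<ε))

-- Dropping an initial segment turns a bound that holds eventually into one for every term, without
-- changing the real number up to `_≈_`.
shift : ℝ → ℕ → ℝ
shift x N = mkℝ (λ k → seq x (N ℕ.+ k)) (λ ε 0<ε →
  let M , h = cauchy x ε 0<ε
  in M , λ k l M≤k M≤l → h (N ℕ.+ k) (N ℕ.+ l)
       (ℕ.≤-trans M≤k (ℕ.m≤n+m k N)) (ℕ.≤-trans M≤l (ℕ.m≤n+m l N)))

shift≈ : ∀ x N → shift x N ≈ x
shift≈ x N ε 0<ε =
  let M , h = cauchy x ε 0<ε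
  in M , λ k M≤k → h (N ℕ.+ k) k (ℕ.≤-trans M≤k (ℕ.m≤n+m k N)) M≤k

recipℝ : ∀ x → (∀ k → 1ℚ ≤ seq x k) → ℝ
recipℝ x 1≤x = mkℝ (λ k → recip (seq x k) (1≤x k)) (λ ε 0<ε →
  let N , h = cauchy x ε 0<ε
  in N , λ k l N≤k N≤l → ≤-trans (∣recip-recip∣≤ (1≤x k) (1≤x l)) (h k l N≤k N≤l))

-- A joint limit in the series index and the approximation index. The limit is a bare sequence, so
-- that its Cauchy property can be a consequence.
Approximates : (ℕ → ℝ) → (ℕ → ℚ) → Set
Approximates s y = ∀ ε → 0ℚ < ε →
  ∃[ N ] (∀ n k → N ℕ.≤ n → N ℕ.≤ k → ∣ seq (s n) k - y k ∣ ≤ ε)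

∣q-p∣≤ : ∀ p q {ε} → ∣ p - q ∣ ≤ ε → ∣ q - p ∣ ≤ ε
∣q-p∣≤ p q = ≤-trans (≤-reflexive (trans (cong ∣_∣ (swap p q)) (∣-p∣≡∣p∣ (p - q))))
  where
  swap : ∀ p q → q - p ≡ - (p - q)
  swap = solve-∀ ℚ-ring

-- Passes from y k to y l through one fixed real `s M`, whose own Cauchy property controls the
-- middle difference. The three errors δ fit into ε = 4δ.
approximates⇒cauchy : ∀ {s y} → Approximates s y → IsCauchy y
approximates⇒cauchy {s} {y} s~y ε 0<ε =
  let η , 0<η , η+η≡ε = halve ε 0<ε
      δ , 0<δ , δ+δ≡η = halve η 0<η
      M , s-y         = s~y δ 0<δ
      N , s-s         = cauchy (s M) δ 0<δ
      three≤four      = ≤-trans (p≤p+q (<⇒≤ 0<δ)) (≤-reflexive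
        (trans (+-assoc (δ + δ) δ δ) (trans (cong₂ _+_ δ+δ≡η δ+δ≡η) η+η≡ε)))
  in M ℕ.⊔ N , λ k l K≤k K≤l → ≤-trans
       (∣p∣≤q-resp-≡ (telescope (y k) (seq (s M) k) (seq (s M) l) (y l)) refl
         (∣p+q∣≤ {y k - seq (s M) k + (seq (s M) k - seq (s M) l)} (∣p+q∣≤ {y k - seq (s M) k}
           (∣q-p∣≤ (seq (s M) k) (y k) (s-y M k ℕ.≤-refl (ℕ.m⊔n≤o⇒m≤o M N K≤k)))
           (s-s k l (ℕ.m⊔n≤o⇒n≤o M N K≤k) (ℕ.m⊔n≤o⇒n≤o M N K≤l)))
           (s-y M l ℕ.≤-refl (ℕ.m⊔n≤o⇒m≤o M N K≤l))))
       three≤four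
  where
  telescope : ∀ a b c d → a - d ≡ (a - b) + (b - c) + (c - d)
  telescope = solve-∀ ℚ-ring

approximates⇒⟶ : ∀ {s ℓ} → Approximates s (seq ℓ) → s ⟶ ℓ
approximates⇒⟶ {s} {ℓ} s~ℓ ε 0<ε =
  let η , 0<η , η+η≡ε = halve ε 0<ε
      N , s-ℓ         = s~ℓ η 0<η
  in N , λ n N≤n →
       -- Strict inequality of reals requires a rational gap: half of ε absorbs the approximation
       -- error, the other half is the gap.
       (η , 0<η , N , λ k N≤k → 0≤q-p⇒p≤q (subst (0ℚ ≤_)
         (trans (lower (seq (s n) k) (seq ℓ k) η)
           (cong (λ z → seq (s n) k - (seq ℓ k - z + η)) η+η≡ε))
         (p≤q⇒0≤q-p (≤-trans (p≤∣p∣ (seq ℓ k - seq (s n) k))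
           (∣q-p∣≤ (seq (s n) k) (seq ℓ k) (s-ℓ n k N≤n N≤k)))))) ,
       (η , 0<η , N , λ k N≤k → 0≤q-p⇒p≤q (subst (0ℚ ≤_)
         (trans (upper (seq (s n) k) (seq ℓ k) η)
           (cong (λ z → seq ℓ k + z - (seq (s n) k + η)) η+η≡ε))
         (p≤q⇒0≤q-p (≤-trans (p≤∣p∣ (seq (s n) k - seq ℓ k)) (s-ℓ n k N≤n N≤k)))))
  where
  lower : ∀ a l η → η - (l - a) ≡ a - (l - (η + η) + η)
  lower = solve-∀ ℚ-ring
  upper : ∀ a l η → η - (a - l) ≡ l + (η + η) - (a + η)
  upper = solve-∀ ℚ-ring

seq-^ : ∀ x n k → seq (x Real.^ n) k ≡ pow (seq x k) n
seq-^ x zero    k = refl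
seq-^ x (suc n) k = cong (seq x k *_) (seq-^ x n k)

seq-expPartialSum : ∀ x n k → seq (expPartialSum x n) k ≡ E (seq x k) n
seq-expPartialSum x zero    k = refl
seq-expPartialSum x (suc n) k =
  cong₂ _+_ (seq-expPartialSum x n k) (cong (_* 1/! (suc n)) (seq-^ x (suc n) k))

-- e^{-w} represented by the reciprocals of the partial sums of e^w, which makes
-- it visible in each term that it lies in [0, 1 / (1 + w)].
module ExpNeg (w : ℝ) (0≤w : ∀ k → 0ℚ ≤ seq w k) where

  1+w≤E : ∀ k → 1ℚ + seq w k ≤ E (seq w k) (suc k)
  1+w≤E k = 1+q≤E (0≤w k) k

  1≤E : ∀ k → 1ℚ ≤ E (seq w k) (suc k)
  1≤E k = ≤-trans (p≤p+q (0≤w k)) (1+w≤E k)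

  y : ℕ → ℚ
  y k = recip (E (seq w k) (suc k)) (1≤E k)

  -- The argument `seq w k` moves with k but is eventually bounded, which is where the uniformity of
  -- `E-inverse` enters.
  approximates : Approximates (expPartialSum (Real.- w)) y
  approximates ε 0<ε =
    let B , _ , N₁ , w≤B = eventually-bounded (seq w) (cauchy w)
        N₂ , inverse     = E-inverse B ε 0<ε
    in N₁ ℕ.⊔ N₂ , λ n k N≤n N≤k → ∣p∣≤q-resp-≡
         (cong (λ z → z - y k) (seq-expPartialSum (Real.- w) n k)) refl
         (∣p-recip∣≤ (1≤E k) (E (- seq w k) n) (inverse (0≤w k)
           (≤-trans (p≤∣p∣ (seq w k)) (w≤B k (ℕ.m⊔n≤o⇒m≤o N₁ N₂ N≤k)))
           (ℕ.m⊔n≤o⇒n≤o N₁ N₂ N≤n)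
           (ℕ.≤-trans (ℕ.m⊔n≤o⇒n≤o N₁ N₂ N≤k) (ℕ.n≤1+n k))))

  expNeg : ℝ
  expNeg = mkℝ y (approximates⇒cauchy {expPartialSum (Real.- w)} approximates)

  prob : ℝ
  prob = 1ℝ Real.- expNeg

  1-prob≡y : ∀ k → 1ℚ - seq prob k ≡ y k
  1-prob≡y k = cancel (y k)
    where
    cancel : ∀ y → 1ℚ - (1ℚ - y) ≡ y
    cancel = solve-∀ ℚ-ring

  isLn : IsLn (1ℝ Real.- prob) (Real.- w)
  isLn = approximates⇒⟶ {expPartialSum (Real.- w)} {1ℝ Real.- prob} (λ ε 0<ε →
    let N , h = approximates ε 0<ε
    in N , λ n k N≤n N≤k → ∣p∣≤q-resp-≡
         (cong (λ z → seq (expPartialSum (Real.- w) n) k - z) (1-prob≡y k)) refl (h n k N≤n N≤k))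

  0≤seq-prob : ∀ k → 0ℚ ≤ seq prob k
  0≤seq-prob k = p≤q⇒0≤q-p (recip≤1 (1≤E k))

  0≤1-prob : ∀ k → 0ℚ ≤ 1ℚ - seq prob k
  0≤1-prob k = ≤-trans (0≤recip (1≤E k)) (≤-reflexive (sym (1-prob≡y k)))

  -- The inequality exp(-w) ≤ 1 / (1 + w) with the denominator cleared.
  1-prob-small : ∀ k → (1ℚ - seq prob k) * (1ℚ + seq w k) ≤ 1ℚ
  1-prob-small k = ≤-trans (≤-reflexive (cong (λ z → z * (1ℚ + seq w k)) (1-prob≡y k)))
    (recip*≤1 (1≤E k) (1+w≤E k))

-- Expectations

module Expectation (k : ℕ) (K η : ℚ) where

  AlmostSure : ∀ {n} → (Fin n → ℝ) → Set
  AlmostSure p = ∀ i → 0ℚ ≤ seq (p i) k × 0ℚ ≤ 1ℚ - seq (p i) k × 1ℚ - seq (p i) k ≤ η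

  Bounded : ∀ {n} → (Subset n → ℝ) → Set
  Bounded f = ∀ ω → 0ℚ ≤ seq (f ω) k × seq (f ω) k ≤ K

  mean : ∀ {n} → (Fin n → ℝ) → (Subset n → ℝ) → ℚ
  mean p f = seq (𝔼 p f) k

  mean-bounded : ∀ n p (f : Subset n → ℝ) → AlmostSure p → Bounded f →
    0ℚ ≤ mean p f × mean p f ≤ K
  mean-bounded zero    p f p~1 f-bd = f-bd Vec.[]
  mean-bounded (suc n) p f p~1 f-bd =
    let q             = seq (p zero) k
        0≤q , 0≤1-q , _ = p~1 zero
        0≤A , A≤K = mean-bounded n (p ∘ suc) (f ∘ (inside Vec.∷_))
                      (p~1 ∘ suc) (f-bd ∘ (inside Vec.∷_))
        0≤B , B≤K = mean-bounded n (p ∘ suc) (f ∘ (outside Vec.∷_))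
                      (p~1 ∘ suc) (f-bd ∘ (outside Vec.∷_))
    in 0≤p+q (0≤p*q 0≤q 0≤A) (0≤p*q 0≤1-q 0≤B) ,
       ≤-trans (+-mono-≤ (*-monoˡ-≤-nonNeg q {{nonNegative 0≤q}} A≤K)
                         (*-monoˡ-≤-nonNeg (1ℚ - q) {{nonNegative 0≤1-q}} B≤K))
         (≤-reflexive (merge q K))
    where
    merge : ∀ q K → q * K + (1ℚ - q) * K ≡ K
    merge = solve-∀ ℚ-ring

  -- A union bound: each of n edges fails with probability at most η, and a failure changes the
  -- value by at most K.
  error : ℕ → ℚ
  error n = ι n * (η * K)

  error-suc : ∀ n → error (suc n) ≡ η * K + error n
  error-suc n = trans (cong (_* (η * K)) (ι-suc n)) (expand (ι n) (η * K))
    where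
    expand : ∀ a b → (1ℚ + a) * b ≡ b + a * b
    expand = solve-∀ ℚ-ring

  add-error-0 : ∀ a → a ≡ a + error 0
  add-error-0 a = sym (trans (cong (λ z → a + z * (η * K)) ι-0)
    (trans (cong (λ z → a + z) (*-zeroˡ (η * K))) (+-identityʳ a)))

  -- Condition on the first edge, with conditional means A and B in [0, K]. The mean exceeds A by (1
  -- - q) * (B - A) ≤ η * K, and A is compared with the value at `⊤` by induction.
  mean≤ : ∀ n p (f : Subset n → ℝ) → AlmostSure p → Bounded f →
    mean p f ≤ seq (f ⊤) k + error n
  mean≤ zero    p f p~1 f-bd = ≤-reflexive (add-error-0 (seq (f Vec.[]) k))
  mean≤ (suc n) p f p~1 f-bd =
    let q               = seq (p zero) k
        A               = mean (p ∘ suc) (f ∘ (inside Vec.∷_))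
        B               = mean (p ∘ suc) (f ∘ (outside Vec.∷_))
        _ , 0≤1-q , 1-q≤η = p~1 zero
        0≤A , A≤K = mean-bounded n (p ∘ suc) (f ∘ (inside Vec.∷_))
                      (p~1 ∘ suc) (f-bd ∘ (inside Vec.∷_))
        0≤B , B≤K = mean-bounded n (p ∘ suc) (f ∘ (outside Vec.∷_))
                      (p~1 ∘ suc) (f-bd ∘ (outside Vec.∷_))
        0≤K       = ≤-trans 0≤A A≤K
    in ≤-trans
      (0≤q-p⇒p≤q {q * A + (1ℚ - q) * B} {A + η * K} (subst (0ℚ ≤_) (regroup q A B η K)
        (0≤p+q (0≤p+q (0≤p*q 0≤1-q 0≤A) (0≤p*q 0≤1-q (p≤q⇒0≤q-p B≤K)))
          (0≤p*q (p≤q⇒0≤q-p 1-q≤η) 0≤K))))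
      (≤-trans (+-monoˡ-≤ (η * K)
          (mean≤ n (p ∘ suc) (f ∘ (inside Vec.∷_)) (p~1 ∘ suc) (f-bd ∘ (inside Vec.∷_))))
        (≤-reflexive (trans (rotate (seq (f ⊤) k) (error n) (η * K))
          (cong (λ z → seq (f ⊤) k + z) (sym (error-suc n))))))
    where
    regroup : ∀ q A B η K →
      (1ℚ - q) * A + (1ℚ - q) * (K - B) + (η - (1ℚ - q)) * K
      ≡ A + η * K - (q * A + (1ℚ - q) * B)
    regroup = solve-∀ ℚ-ring
    rotate : ∀ a b c → a + b + c ≡ a + (c + b)
    rotate = solve-∀ ℚ-ring

  -- As for `mean≤`, with the roles of A and B exchanged in the one-edge estimate.
  ≤mean : ∀ n p (f : Subset n → ℝ) → AlmostSure p → Bounded f →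
    seq (f ⊤) k ≤ mean p f + error n
  ≤mean zero    p f p~1 f-bd = ≤-reflexive (add-error-0 (seq (f Vec.[]) k))
  ≤mean (suc n) p f p~1 f-bd =
    let q               = seq (p zero) k
        A               = mean (p ∘ suc) (f ∘ (inside Vec.∷_))
        B               = mean (p ∘ suc) (f ∘ (outside Vec.∷_))
        _ , 0≤1-q , 1-q≤η = p~1 zero
        0≤A , A≤K = mean-bounded n (p ∘ suc) (f ∘ (inside Vec.∷_))
                      (p~1 ∘ suc) (f-bd ∘ (inside Vec.∷_))
        0≤B , B≤K = mean-bounded n (p ∘ suc) (f ∘ (outside Vec.∷_))
                      (p~1 ∘ suc) (f-bd ∘ (outside Vec.∷_))
        0≤K       = ≤-trans 0≤A A≤K
    in ≤-trans (≤mean n (p ∘ suc) (f ∘ (inside Vec.∷_)) (p~1 ∘ suc) (f-bd ∘ (inside Vec.∷_)))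
      (≤-trans (+-monoˡ-≤ (error n) (0≤q-p⇒p≤q {A} {mean p f + η * K}
          (subst (0ℚ ≤_) (regroup q A B η K)
            (0≤p+q (0≤p+q (0≤p*q 0≤1-q 0≤B) (0≤p*q 0≤1-q (p≤q⇒0≤q-p A≤K)))
              (0≤p*q (p≤q⇒0≤q-p 1-q≤η) 0≤K)))))
        (≤-reflexive (trans (+-assoc (mean p f) (η * K) (error n))
          (cong (λ z → mean p f + z) (sym (error-suc n))))))
    where
    regroup : ∀ q A B η K →
      (1ℚ - q) * B + (1ℚ - q) * (K - A) + (η - (1ℚ - q)) * K
      ≡ q * A + (1ℚ - q) * B + η * K - A
    regroup = solve-∀ ℚ-ring

fromℕ-bounded : ∀ {n k η} (g : Subset n → ℕ) B → (∀ ω → g ω ℕ.≤ B) →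
  Expectation.Bounded k (ι B) η (fromℕ ∘ g)
fromℕ-bounded g B g≤B ω =
  subst (λ z → 0ℚ ≤ z × z ≤ ι B) (ι≡/1 (g ω)) (0≤ι (g ω) , ι-mono-≤ (g≤B ω))

-- ratio≤ reads (m + 2) / (2 m - 1) ≤ ½ + δ when M = m - 1.
ratio≤ : ∀ {M δ g b} → 0ℚ ≤ M → 0ℚ ≤ δ → 1ℚ + 1ℚ + 1ℚ ≤ δ * M →
  g ≤ 1ℚ + (1ℚ + M) + 1ℚ → 1ℚ + M + (1ℚ + M) ≤ b + 1ℚ → g ≤ (½ + δ) * b
ratio≤ {M} {δ} {g} {b} 0≤M 0≤δ 3≤δM g≤ ≤b = 0≤q-p⇒p≤q (subst (0ℚ ≤_) (regroup M δ g b)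
  (0≤p+q (0≤p+q (0≤p*q (0≤p+q 0≤½ 0≤δ) (p≤q⇒0≤q-p ≤b)) (p≤q⇒0≤q-p g≤))
    (0≤p+q (0≤p+q (0≤p+q 0≤½ 0≤δ) (0≤p+q (p≤q⇒0≤q-p 3≤δM) (p≤q⇒0≤q-p 3≤δM)))
      (0≤p+q (0≤p+q 0≤1 0≤1) 0≤1))))
  where
  0≤1 : 0ℚ ≤ 1ℚ
  0≤1 = <⇒≤ 0<1ℚ
  0≤½ : 0ℚ ≤ ½
  0≤½ = nonNegative⁻¹ ½
  regroup : ∀ M δ g b →
    (½ + δ) * (b + 1ℚ - (1ℚ + M + (1ℚ + M))) + (1ℚ + (1ℚ + M) + 1ℚ - g)
      + (½ + δ + (δ * M - (1ℚ + 1ℚ + 1ℚ) + (δ * M - (1ℚ + 1ℚ + 1ℚ))) + (1ℚ + 1ℚ + 1ℚ))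
    ≡ (½ + δ) * b - g
  regroup = solve-∀ ℚ-ring

-- From almost sure realization to a bound on the ratio

module AlmostSurelyRealized (G : StochasticGraph) (π : Perm.Permutation′ (StochasticGraph.nE G))
  (η : ℕ → ℚ) where

  open StochasticGraph G

  module _ (k : ℕ)
    (p~1 : Expectation.AlmostSure k (ι nE) (η k) prob)
    (error≤1 : ι nE * (η k * ι nE) ≤ 1ℚ) where

    open Expectation k (ι nE) (η k)

    -- The number of edges also bounds every matching size, which is why it enters the error twice.
    GREEDY≤ : ∀ {a} → ∣ greedy G π ⊤ ∣ₛ ℕ.≤ a → seq (GREEDY G π) k ≤ ι a + 1ℚ
    GREEDY≤ ∣greedy∣≤a = ≤-trans
      (mean≤ nE prob (λ ω → fromℕ ∣ greedy G π ω ∣ₛ) p~1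
        (fromℕ-bounded {k = k} {η k} (λ ω → ∣ greedy G π ω ∣ₛ) nE (λ ω → ∣p∣≤n (greedy G π ω))))
      (+-mono-≤ (≤-trans (≤-reflexive (sym (ι≡/1 ∣ greedy G π ⊤ ∣ₛ))) (ι-mono-≤ ∣greedy∣≤a))
        error≤1)

    ≤OPT : ∀ {b} → b ℕ.≤ maxMatchingSize G ⊤ → ι b ≤ seq (OPT G) k + 1ℚ
    ≤OPT b≤max = ≤-trans (≤-trans (ι-mono-≤ b≤max) (≤-reflexive (ι≡/1 (maxMatchingSize G ⊤))))
      (≤-trans (≤mean nE prob (fromℕ ∘ maxMatchingSize G) p~1
          (fromℕ-bounded {k = k} {η k} (maxMatchingSize G) nE (maxMatchingSize≤nE G)))
        (+-monoʳ-≤ (seq (OPT G) k) error≤1))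

  module _ (m : ℕ) {δ : ℚ} (0<δ : 0ℚ < δ) (3≤δm : 1ℚ + 1ℚ + 1ℚ ≤ δ * ι m)
    (p~1 : ∀ k → Expectation.AlmostSure k (ι nE) (η k) prob)
    (error≤1 : ∀ k → ι nE * (η k * ι nE) ≤ 1ℚ)
    (∣greedy∣≤ : ∣ greedy G π ⊤ ∣ₛ ℕ.≤ suc (suc m))
    (≤max : suc m ℕ.+ suc m ℕ.≤ maxMatchingSize G ⊤) where

    private
      b : ℕ → ℚ
      b = seq (OPT G)

    2+2m≤b+1 : ∀ k → 1ℚ + ι m + (1ℚ + ι m) ≤ b k + 1ℚ
    2+2m≤b+1 k = ≤-trans (≤-reflexive (sym (trans (ι-homo-+ (suc m) (suc m))
      (cong₂ _+_ (ι-suc m) (ι-suc m))))) (≤OPT k (p~1 k) (error≤1 k) ≤max)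

    -- A lower bound on every term, so that the quotient can be formed termwise.
    1≤OPT : ∀ k → 1ℚ ≤ b k
    1≤OPT k = 0≤q-p⇒p≤q (subst (0ℚ ≤_) (regroup (ι m) (b k))
      (0≤p+q (p≤q⇒0≤q-p (2+2m≤b+1 k)) (0≤p+q (0≤ι m) (0≤ι m))))
      where
      regroup : ∀ M b → b + 1ℚ - (1ℚ + M + (1ℚ + M)) + (M + M) ≡ b - 1ℚ
      regroup = solve-∀ ℚ-ring

    ratio : ℝ
    ratio = GREEDY G π Real.* recipℝ (OPT G) 1≤OPT

    cancel : ∀ p k → p * recip (b k) (1≤OPT k) * b k ≡ p
    cancel p k = trans (*-assoc p (recip (b k) (1≤OPT k)) (b k))
      (trans (cong (p *_) (trans (*-comm (recip (b k) (1≤OPT k)) (b k)) (*-recip (1≤OPT k))))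
        (*-identityʳ p))

    isQuotient : IsQuotient (GREEDY G π) (OPT G) ratio
    isQuotient = (1ℚ , 0<1ℚ , 0 , λ k _ → ≤-trans (≤-reflexive (+-identityˡ 1ℚ)) (1≤OPT k)) ,
      ≗⇒≈ {ratio Real.* OPT G} {GREEDY G π} (λ k → cancel (seq (GREEDY G π) k) k)

    seq-ratio≤ : ∀ k → seq ratio k ≤ ½ + δ
    seq-ratio≤ k = *-cancelʳ-≤-pos (b k) {{positive (<-≤-trans 0<1ℚ (1≤OPT k))}}
      (≤-trans (≤-reflexive (cancel (seq (GREEDY G π) k) k))
        (ratio≤ (0≤ι m) (<⇒≤ 0<δ) 3≤δm
          (≤-trans (GREEDY≤ k (p~1 k) (error≤1 k) ∣greedy∣≤) (≤-reflexive (cong (λ z → z + 1ℚ)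
            (trans (ι-suc (suc m)) (cong (λ z → 1ℚ + z) (ι-suc m))))))
          (2+2m≤b+1 k)))

    ρ< : ∀ c {h} → δ + δ ≡ h → Vertex → IsLogNormalizedRegular G c → ρ c (fromℚ (½ + h))
    ρ< c δ+δ≡h v regular = ratio , (G , v , regular , π , isQuotient) ,
      -- One δ is the excess of the ratio over one half, the other is the gap that `inf` demands.
      (δ , 0<δ , 0 , λ k _ → ≤-trans (+-monoˡ-≤ δ (seq-ratio≤ k))
        (≤-reflexive (trans (+-assoc ½ δ δ) (cong (λ z → ½ + z) δ+δ≡h))))

-- This is where a weight of at least the square of the number of edges is used.
error-small : ∀ {n η w} → 0ℚ ≤ η → η * (1ℚ + w) ≤ 1ℚ → ι (n ℕ.* n) ≤ w → ι n * (η * ι n) ≤ 1ℚ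
error-small {n} {η} {w} 0≤η η*≤1 n²≤w = begin
  ι n * (η * ι n)   ≡⟨ swap (ι n) η ⟩
  η * (ι n * ι n)   ≡⟨ cong (λ z → η * z) (ι-homo-* n n) ⟨
  η * ι (n ℕ.* n)   ≤⟨ *-monoˡ-≤-nonNeg η {{nonNegative 0≤η}} (≤-trans n²≤w p≤1+p) ⟩
  η * (1ℚ + w)      ≤⟨ η*≤1 ⟩
  1ℚ                ∎
  where
  open ≤-Reasoning
  swap : ∀ a b → a * (b * a) ≡ b * (a * a)
  swap = solve-∀ ℚ-ring
  p≤1+p : w ≤ 1ℚ + w
  p≤1+p = ≤-trans (p≤p+q (<⇒≤ 0<1ℚ)) (≤-reflexive (+-comm w 1ℚ))

-- The weighted graph for a given c

module Instance (m : ℕ) (c : ℝ) (N : ℕ)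
  (c-large : ∀ k → ι (suc m) * ι (edgeCount m ℕ.* edgeCount m) ≤ seq c (N ℕ.+ k)) where

  -- Built from the shifted c, so that every term of the weight is large; `ExpNeg` needs nonnegative
  -- terms from index 0 on.
  w : ℝ
  w = fromℚ (+ 1 / suc m) Real.* shift c N

  m+1*w≡c : ∀ k → ι (suc m) * seq w k ≡ seq c (N ℕ.+ k)
  m+1*w≡c k = trans (sym (*-assoc (ι (suc m)) (+ 1 / suc m) (seq c (N ℕ.+ k))))
    (trans (cong (_* seq c (N ℕ.+ k)) (ι*1/ (suc m))) (*-identityˡ (seq c (N ℕ.+ k))))

  w-large : ∀ k → ι (edgeCount m ℕ.* edgeCount m) ≤ seq w k
  w-large k = *-cancelˡ-≤-pos (ι (suc m)) {{positive (0<ι-suc m)}}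
    (≤-trans (c-large k) (≤-reflexive (sym (m+1*w≡c k))))

  open ExpNeg w (λ k → ≤-trans (0≤ι (edgeCount m ℕ.* edgeCount m)) (w-large k)) public

  open Family m prob
    (pointwise⇒≤ {0ℝ} {prob} 0≤seq-prob)
    (pointwise⇒≤ {prob} {1ℝ} (λ k → 0≤q-p⇒p≤q (0≤1-prob k))) public

  regular : IsLogNormalizedRegular G c
  regular = (λ _ → w) , (λ _ → isLn) , λ v ε 0<ε →
    let M , h = shift≈ c N ε 0<ε
    in M , λ k M≤k → ∣p∣≤q-resp-≡
         (cong (λ z → z - seq c k) (trans (weightedDegree≡ w v k) (m+1*w≡c k))) refl (h k M≤k)

theorem3p2 : limsup ρ ≤ᵘ ½ℝ
theorem3p2 x (ε , 0<ε , N , ½+ε≤x) =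
  -- One h is the gap demanded by `⨆`; the other is split into two δ, for the excess of the ratio
  -- over one half and for the gap in `inf`.
  let h , 0<h , h+h≡ε  = halve ε 0<ε
      δ , 0<δ , δ+δ≡h  = halve h 0<h
      t , _ , δ*t≡3    = divide δ 0<δ (1ℚ + 1ℚ + 1ℚ) (positive⁻¹ (1ℚ + 1ℚ + 1ℚ))
      m , t≤m          = archimedean t
      -- The graph is used with `suc m` leaves per side, so its degree is m + 2, and c ≥ C makes
      -- each weight c / (m + 2) at least the square of the number of edges.
      C                = ι (suc (suc m)) * ι (edgeCount (suc m) ℕ.* edgeCount (suc m))
      3≤δ*m            = ≤-trans (≤-reflexive (sym δ*t≡3))
                           (*-monoˡ-≤-nonNeg δ {{nonNegative (<⇒≤ 0<δ)}} t≤m)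
  -- The additional 1 pays for the tolerance in `_≤_`: taken at tolerance 1, the hypothesis on c
  -- yields C ≤ `seq c n` for all n from some index on.
  in fromℚ (C + 1ℚ) ,
     fromℚ (½ + h) ,
     (h , 0<h , N , λ k N≤k → ≤-trans
       (≤-reflexive (trans (+-assoc ½ h h) (cong (λ z → ½ + z) h+h≡ε))) (½+ε≤x k N≤k)) ,
     λ (c , C+1≤c) →
       let N₀ , C+1≤c+1 = C+1≤c 1ℚ 0<1ℚ
       in ρ<½+h m 0<δ δ+δ≡h 3≤δ*m c N₀ (λ k →
            +-cancelʳ-≤ (C+1≤c+1 (N₀ ℕ.+ k) (ℕ.m≤m+n N₀ k)))
  where
  +-cancelʳ-≤ : ∀ {p q} → p + 1ℚ ≤ q + 1ℚ → p ≤ q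
  +-cancelʳ-≤ {p} {q} h = 0≤q-p⇒p≤q (subst (0ℚ ≤_) (cancel p q) (p≤q⇒0≤q-p h))
    where
    cancel : ∀ p q → q + 1ℚ - (p + 1ℚ) ≡ q - p
    cancel = solve-∀ ℚ-ring

  ρ<½+h : ∀ m {δ h} → 0ℚ < δ → δ + δ ≡ h → 1ℚ + 1ℚ + 1ℚ ≤ δ * ι m → ∀ c N →
    (∀ k → ι (suc (suc m)) * ι (edgeCount (suc m) ℕ.* edgeCount (suc m)) ≤ seq c (N ℕ.+ k)) →
    ρ c (fromℚ (½ + h))
  ρ<½+h m 0<δ δ+δ≡h 3≤δ*m c N c-large =
    AlmostSurelyRealized.ρ< I.G Perm.id (λ k → 1ℚ - seq I.prob k) m 0<δ 3≤δ*m
      (λ k _ → I.0≤seq-prob k , I.0≤1-prob k , ≤-refl)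
      (λ k → error-small {edgeCount (suc m)} (I.0≤1-prob k) (I.1-prob-small k) (I.w-large k))
      I.∣greedy∣≤ I.≤maxMatchingSize c δ+δ≡h (inj₁ zero) I.regular
    where module I = Instance (suc m) c N c-large
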